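{- If $G$ is an almost wheel-free 3-connected graph, then $G$ contains two disjoint pairs of twins.
   Context: Graphs are finite, simple and undirected. A wheel $(C,v)$ in a graph $G$ consists of a cycle $C$ of $G$ (as a subgraph, not necessarily induced) and a vertex $v\in V(G)\setminus V(C)$ (the center) having at least three neighbors in $V(C)$. $W(G)$ denotes the set of all vertices $u$ of $G$ such that at least one wheel of $G$ is centered at $u$. A graph $G$ is almost wheel-free if $W(G)$ is either empty, or made of a single vertex of degree 3 in $G$, or made of two adjacent vertices, both of degree 3 in $G$. Two distinct vertices $u$ and $v$ of a graph are twins if they are non-adjacent, of degree 3, and $N(u)=N(v)$; then $\{u,v\}$ is a pair of twins. -}

module Defs where

open import Data.Fin using (Fin; zero; suc; inject₁; fromℕ)
open import Data.Fin.Properties using (_≟_; any?)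
open import Data.Fin.Subset using (Subset; _∉_; _∩_; ∣_∣)
open import Data.Nat using (ℕ; suc; _≤_; _<_)
open import Data.Product using (_×_; ∃; ∃₂)
open import Data.Sum using (_⊎_)
open import Data.Vec using (tabulate)
open import Level using (0ℓ)
open import Function.Definitions using (Injective)
open import Relation.Binary using (Rel; Decidable; Symmetric; Irreflexive)
open import Relation.Binary.Construct.Closure.ReflexiveTransitive using (Star)
open import Relation.Binary.PropositionalEquality using (_≡_; _≢_)
open import Relation.Nullary using (¬_; does)
open import Relation.Unary using (Pred; Empty; ｛_｝; _∪_; _≐_)

record Graph (n : ℕ) : Set₁ where
  field
    Adj    : Rel (Fin n) 0ℓ
    adj?   : Decidable Adj
    sym    : Symmetric Adj
    irrefl : Irreflexive _≡_ Adj

module _ {n : ℕ} (G : Graph n) where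
  open Graph G

  N : Fin n → Subset n
  N v = tabulate λ u → does (adj? v u)

  degree : Fin n → ℕ
  degree v = ∣ N v ∣

  AdjOutside : Subset n → Rel (Fin n) 0ℓ
  AdjOutside S u v = u ∉ S × v ∉ S × Adj u v

  -- A walk in G − S is an element of Star (AdjOutside S); the condition
  -- k < n is the usual requirement of at least k + 1 vertices.
  KConnected : ℕ → Set
  KConnected k = k < n ×
    (∀ (S : Subset n) → ∣ S ∣ < k →
     ∀ u v → u ∉ S → v ∉ S → Star (AdjOutside S) u v)

  -- A cycle of length 3 + m, as a cyclic enumeration of its vertices.
  -- Chords are allowed.
  record Cycle : Set where
    field
      m         : ℕ
      vertex    : Fin (suc (suc (suc m))) → Fin n
      injective : Injective _≡_ _≡_ vertex
      step      : ∀ (i : Fin (suc (suc m))) → Adj (vertex (inject₁ i)) (vertex (suc i))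
      close     : Adj (vertex (fromℕ (suc (suc m)))) (vertex zero)

  V : Cycle → Subset n
  V C = tabulate λ v → does (any? λ i → Cycle.vertex C i ≟ v)

  IsWheel : Cycle → Fin n → Set
  IsWheel C v = v ∉ V C × 3 ≤ ∣ N v ∩ V C ∣

  W : Pred (Fin n) 0ℓ
  W v = ∃ λ C → IsWheel C v

  AlmostWheelFree : Set
  AlmostWheelFree =
      Empty W
    ⊎ (∃ λ u → W ≐ ｛ u ｝ × degree u ≡ 3)
    ⊎ (∃₂ λ u v → W ≐ ｛ u ｝ ∪ ｛ v ｝ × Adj u v × degree u ≡ 3 × degree v ≡ 3)

  Twins : Rel (Fin n) 0ℓ
  Twins u v = u ≢ v × ¬ Adj u v × degree u ≡ 3 × degree v ≡ 3 × N u ≡ N v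

{-# OPTIONS --safe #-}

-- Let D be a set of vertices inducing a 2-connected graph (or an edge), containing a prescribed vertex r,
-- such that G − D contains a cycle, and let D be maximal with this property. Let E be a shortest ear of D:
-- a path outside D whose two ends have different neighbours α, β in D. By maximality the graph outside D ∪ E
-- is a forest, and D ∪ E is 2-connected, so that every path outside D ∪ E with two different attachments closes
-- to a cycle through any prescribed vertex of D ∪ E.
--
-- G is triangle-free, because every vertex of a triangle is the centre of a wheel, and two different centres are
-- adjacent vertices of degree three. Since E is shortest, a leaf t of the forest is as a rule adjacent to both
-- neighbours in D ∪ E of some vertex c of E. Exchanging c and t gives another shortest ear; if t is not a centre,
-- all paths through the third neighbour s of t must end at c, which makes s a neighbour of c and {c, t} a pair of
-- twins avoiding r. The remaining positions of t (E has at most three vertices and t has a neighbour in D other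
-- than α and β) reduce to this one, and not all leaves can be centres.
--
-- Taking r arbitrary yields twins {a, b}; taking r = a yields twins avoiding a. If these contain b, there are three
-- vertices with the same three neighbours, and then either two of them are centres or G is K₃,₃.

module Submission where

open import Defs
open import Data.Bool.Properties using () renaming (_≟_ to _≟ᵇ_)
open import Data.Empty using (⊥-elim)
open import Data.Fin using (Fin; zero; suc; inject₁; fromℕ; fromℕ<)
open import Data.Fin.Properties using (_≟_; any?)
open import Data.Fin.Subset as Sub using (Subset; ∣_∣; ⁅_⁆; _-_; ⊤) renaming (_∪_ to _∪ₛ_)
open import Data.Fin.Subset.Properties
  using (∣⊤∣≡n; x∈p⇒∣p-x∣<∣p∣; x∈p∧x≢y⇒x∈p-y; ∪-identityˡ; p⊆q⇒∣p∣≤∣q∣; ∣⊥∣≡0; ⊆-antisym;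
         x∈p∩q⁺; x∈p∪q⁻; x∈p∪q⁺; x∈⁅y⁆⇒x≡y; x∈⁅x⁆; ∈⊤)
open import Data.List using (List; []; _∷_; _++_; length; reverse; lookup; foldr; filter; allFin)
open import Data.List.Properties using (++-assoc; unfold-reverse; length-++; filter-notAll)
open import Data.List.Membership.Propositional using (_∈_; _∉_)
open import Data.List.Membership.Propositional.Properties
  using (∈-++⁺ˡ; ∈-++⁺ʳ; ∈-++⁻; ∈-∃++; ∈-insert; ∈-lookup; ∈-filter⁺; ∈-filter⁻; ∈-allFin)
open import Data.List.Relation.Unary.All using (All; []; _∷_)
open import Data.List.Relation.Unary.All.Properties using (¬Any⇒All¬; All¬⇒¬Any)
open import Data.List.Relation.Unary.AllPairs using ([]; _∷_)
open import Data.List.Relation.Unary.Any as Any using (here; there; index)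
open import Data.List.Relation.Unary.Any.Properties using (reverse⁺; reverse⁻; lookup-index)
open import Data.List.Relation.Unary.Unique.Propositional using (Unique)
open import Data.List.Relation.Unary.Unique.Propositional.Properties using (++⁺)
open import Data.Nat using (ℕ; zero; suc; _+_; _≤_; _<_; z≤n; s≤s) renaming (_≟_ to _≟ⁿ_)
open import Data.Nat.Properties
  using (≤-trans; ≤-refl; ≤-reflexive; ≤-antisym; <-≤-trans; <⇒≱; ≰⇒>; n≤1+n; m≤n+m;
         +-identityʳ; +-suc; +-cancelʳ-≤)
open import Data.Product using (Σ-syntax; _×_; _,_; proj₁; proj₂; ∃; ∃₂)
open import Data.Sum using (_⊎_; inj₁; inj₂; [_,_]; [_,_]′; map₁; map₂)
open import Data.Vec as Vec using (tabulate)
open import Data.Vec.Properties using (lookup∘tabulate; []=⇒lookup; lookup⇒[]=; ≡-dec)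
open import Function.Definitions using (Injective)
open import Level using (0ℓ)
open import Relation.Binary.Construct.Closure.ReflexiveTransitive using (Star; ε) renaming (_◅_ to _◅ˢ_)
open import Relation.Binary.PropositionalEquality
  using (_≡_; _≢_; refl; cong; subst; trans) renaming (sym to ≡-sym)
open import Relation.Nullary using (¬_; Dec; yes; no; does; ¬?; _×-dec_; _⊎-dec_)
open import Relation.Nullary.Decidable using (dec-true; decidable-stable)
open import Relation.Unary using (Pred; Decidable)

-- One mechanism produces nearly all wheels. Let `s` be the neighbour outside D ∪ E of a leaf `t`. A
-- path through `s` that avoids `t` and attaches to D ∪ E at two different vertices is an ear of D ∪
-- E. Since D ∪ E is 2-connected, the path closing this ear can be led through one prescribed
-- vertex. If that vertex is a neighbour of `t`, or a vertex `c` whose only neighbours in D ∪ E are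
-- two neighbours of `t`, three neighbours of `t` can be brought onto one cycle. That `c` has no
-- other neighbours in D ∪ E is what minimality of E gives. The obstacle is a path with an end at
-- `c` itself, because the closing path must have `c` in its interior. The exchange of `c` and `t`
-- answers it: maximality also holds for the exchanged ear, so adding `c` to the remaining forest
-- creates no cycle, and `c` cannot be adjacent to two vertices of one path in it. Whether a vertex
-- is a centre is never decided. Statements about leaves therefore end in `¬ ¬ W G t`, and are used
-- by continuations inside proofs of falsity.

module _ {A : Set} where

  -- Lists without repetitions

  infix 4 _⊑_

  _⊑_ : List A → Pred A 0ℓ → Set
  xs ⊑ P = ∀ {v} → v ∈ xs → P v

  ∉⇒≢ : ∀ {x} {xs : List A} → x ∉ xs → All (x ≢_) xs
  ∉⇒≢ = ¬Any⇒All¬ _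

  cons-unique : ∀ {x} {xs : List A} → x ∉ xs → Unique xs → Unique (x ∷ xs)
  cons-unique x∉ u = ∉⇒≢ x∉ ∷ u

  head∉tail : ∀ {x} {xs : List A} → Unique (x ∷ xs) → x ∉ xs
  head∉tail (p ∷ _) = All¬⇒¬Any p

  tail-unique : ∀ {x} {xs : List A} → Unique (x ∷ xs) → Unique xs
  tail-unique (_ ∷ u) = u

  singleton-unique : ∀ {x : A} → Unique (x ∷ [])
  singleton-unique = [] ∷ []

  ++-unique : ∀ {xs ys : List A} → Unique xs → Unique ys → (∀ {v} → v ∈ xs → v ∉ ys) → Unique (xs ++ ys)
  ++-unique u v d = ++⁺ u v λ (p , q) → d p q

  unique-++⁻ : ∀ xs {ys : List A} → Unique (xs ++ ys) →
               Unique xs × Unique ys × (∀ {v} → v ∈ xs → v ∉ ys)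
  unique-++⁻ [] u = [] , u , λ ()
  unique-++⁻ (x ∷ xs) u with unique-++⁻ xs (tail-unique u)
  ... | ux , uy , d = cons-unique (λ m → head∉tail u (∈-++⁺ˡ m)) ux , uy ,
        λ { (here refl) m → head∉tail u (∈-++⁺ʳ xs m) ; (there p) m → d p m }

  reverse-unique : ∀ {xs : List A} → Unique xs → Unique (reverse xs)
  reverse-unique {[]} u = []
  reverse-unique {x ∷ xs} u rewrite unfold-reverse x xs =
    ++-unique (reverse-unique (tail-unique u)) singleton-unique
      λ { p (here refl) → head∉tail u (reverse⁻ p) }

  ∈-snoc⁻ : ∀ xs {v y : A} → v ∈ xs ++ y ∷ [] → v ∈ xs ⊎ v ≡ y
  ∈-snoc⁻ xs m with ∈-++⁻ xs m
  ... | inj₁ p = inj₁ p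
  ... | inj₂ (here e) = inj₂ e

  ∈-mid⁻ : ∀ xs {v y : A} {ys} → v ∈ xs ++ y ∷ ys → v ∈ xs ⊎ v ≡ y ⊎ v ∈ ys
  ∈-mid⁻ xs m with ∈-++⁻ xs m
  ... | inj₁ p = inj₁ p
  ... | inj₂ (here e) = inj₂ (inj₁ e)
  ... | inj₂ (there p) = inj₂ (inj₂ p)

  ∈-mid⁺ : ∀ xs {v y : A} {ys} → v ∈ xs ⊎ v ∈ ys → v ∈ xs ++ y ∷ ys
  ∈-mid⁺ xs (inj₁ p) = ∈-++⁺ˡ p
  ∈-mid⁺ xs (inj₂ p) = ∈-++⁺ʳ xs (there p)

  ordered : ∀ {f g} {w : List A} → f ∈ w → g ∈ w → f ≢ g →
            (∃ λ P → ∃ λ Q → ∃ λ R → w ≡ P ++ f ∷ Q ++ g ∷ R) ⊎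
            (∃ λ P → ∃ λ Q → ∃ λ R → w ≡ P ++ g ∷ Q ++ f ∷ R)
  ordered (here refl) (here refl) f≢g = ⊥-elim (f≢g refl)
  ordered (here refl) (there q) f≢g with ∈-∃++ q
  ... | Q , R , refl = inj₁ ([] , Q , R , refl)
  ordered (there p) (here refl) f≢g with ∈-∃++ p
  ... | Q , R , refl = inj₂ ([] , Q , R , refl)
  ordered (there p) (there q) f≢g with ordered p q f≢g
  ... | inj₁ (P , Q , R , refl) = inj₁ (_ ∷ P , Q , R , refl)
  ... | inj₂ (P , Q , R , refl) = inj₂ (_ ∷ P , Q , R , refl)

-- Sizes of subsets and lengths of lists

∣⁅x⁆∪p∣≤1+∣p∣ : ∀ {n} x (p : Subset n) → ∣ ⁅ x ⁆ ∪ₛ p ∣ ≤ suc ∣ p ∣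
∣⁅x⁆∪p∣≤1+∣p∣ zero (Sub.inside  Vec.∷ p) rewrite ∪-identityˡ p = n≤1+n _
∣⁅x⁆∪p∣≤1+∣p∣ zero (Sub.outside Vec.∷ p) rewrite ∪-identityˡ p = ≤-refl
∣⁅x⁆∪p∣≤1+∣p∣ (suc x) (Sub.inside  Vec.∷ p) = s≤s (∣⁅x⁆∪p∣≤1+∣p∣ x p)
∣⁅x⁆∪p∣≤1+∣p∣ (suc x) (Sub.outside Vec.∷ p) = ∣⁅x⁆∪p∣≤1+∣p∣ x p

length≤∣p∣ : ∀ {n} {l : List (Fin n)} {p} → Unique l → l ⊑ (Sub._∈ p) → length l ≤ ∣ p ∣
length≤∣p∣ {l = []} u s = z≤n
length≤∣p∣ {l = x ∷ l} {p} u s =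
  ≤-trans (s≤s (length≤∣p∣ {p = p - x} (tail-unique u)
            λ m → x∈p∧x≢y⇒x∈p-y (s (there m)) λ { refl → head∉tail u m }))
          (x∈p⇒∣p-x∣<∣p∣ {x = x} {p = p} (s (here refl)))

∣p∣≤length : ∀ {n} (l : List (Fin n)) {p} → (∀ {v} → v Sub.∈ p → v ∈ l) → ∣ p ∣ ≤ length l
∣p∣≤length {n} l {p} s = ≤-trans (p⊆q⇒∣p∣≤∣q∣ (λ m → ∈-union (s m))) (∣union∣ l)
  where
  union : List (Fin n) → Subset n
  union = foldr (λ x q → ⁅ x ⁆ ∪ₛ q) Sub.⊥
  ∈-union : ∀ {v l} → v ∈ l → v Sub.∈ union l
  ∈-union {v} (here refl) = x∈p∪q⁺ (inj₁ (x∈⁅x⁆ v))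
  ∈-union {l = x ∷ _} (there m) = x∈p∪q⁺ {p = ⁅ x ⁆} (inj₂ (∈-union m))
  ∣union∣ : ∀ l → ∣ union l ∣ ≤ length l
  ∣union∣ []      = ≤-reflexive (∣⊥∣≡0 n)
  ∣union∣ (x ∷ l) = ≤-trans (∣⁅x⁆∪p∣≤1+∣p∣ x (union l)) (s≤s (∣union∣ l))

∈-tabulate⁺ : ∀ {n} {P : Pred (Fin n) 0ℓ} (P? : Decidable P) {v} → P v → v Sub.∈ tabulate (λ u → does (P? u))
∈-tabulate⁺ P? {v} p = lookup⇒[]= v _ (trans (lookup∘tabulate _ v) (dec-true (P? v) p))

∈-tabulate⁻ : ∀ {n} {P : Pred (Fin n) 0ℓ} (P? : Decidable P) {v} → v Sub.∈ tabulate (λ u → does (P? u)) → P v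
∈-tabulate⁻ P? {v} m with P? v | trans (≡-sym (lookup∘tabulate (λ u → does (P? u)) v)) ([]=⇒lookup m)
... | yes p | _ = p
... | no _ | ()

lookup-injective : ∀ {A : Set} {l : List A} → Unique l → Injective _≡_ _≡_ (lookup l)
lookup-injective {l = x ∷ l} u {zero}  {zero}  e = refl
lookup-injective {l = x ∷ l} u {zero}  {suc j} e = ⊥-elim (head∉tail u (subst (_∈ l) (≡-sym e) (∈-lookup j)))
lookup-injective {l = x ∷ l} u {suc i} {zero}  e = ⊥-elim (head∉tail u (subst (_∈ l) e (∈-lookup i)))
lookup-injective {l = x ∷ l} u {suc i} {suc j} e = cong suc (lookup-injective (tail-unique u) e)

module _ {n : ℕ} (G : Graph n) where

  open import Data.Empty using (⊥)
  open import Data.List.Membership.DecPropositional (_≟_ {n}) using (_∈?_)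
  open Graph G using (Adj; adj?; sym; irrefl)

  -- Walks and paths

  infix 4 _~_
  infixr 5 _◅_

  _~_ : Fin n → Fin n → Set
  _~_ = Adj

  ~⇒≢ : ∀ {u v} → u ~ v → u ≢ v
  ~⇒≢ a e = irrefl e a

  -- Walk x w y : the list w, both ends included, is a walk from x to y.
  data Walk : Fin n → List (Fin n) → Fin n → Set where
    stop : ∀ {x} → Walk x (x ∷ []) x
    _◅_  : ∀ {x y w z} → x ~ y → Walk y w z → Walk x (x ∷ w) z

  walk-first : ∀ {x w y} → Walk x w y → x ∈ w
  walk-first stop    = here refl
  walk-first (_ ◅ _) = here refl

  walk-last : ∀ {x w y} → Walk x w y → y ∈ w
  walk-last stop    = here refl
  walk-last (_ ◅ p) = there (walk-last p)

  walk-head : ∀ {x b w y} → Walk x (b ∷ w) y → x ≡ b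
  walk-head stop    = refl
  walk-head (_ ◅ _) = refl

  walk-++ : ∀ {x p y z q w} → Walk x p y → y ~ z → Walk z q w → Walk x (p ++ q) w
  walk-++ stop    e q = e ◅ q
  walk-++ (a ◅ p) e q = a ◅ walk-++ p e q

  walk-reverse : ∀ {x w y} → Walk x w y → Walk y (reverse w) x
  walk-reverse stop = stop
  walk-reverse (_◅_ {x} {w = w} a p) rewrite unfold-reverse x w =
    walk-++ (walk-reverse p) (sym a) stop

  walk-split : ∀ P {Q x f y} → Walk x (P ++ f ∷ Q) y → Walk x (P ++ f ∷ []) f × Walk f (f ∷ Q) y
  walk-split []          stop    = stop , stop
  walk-split []          (a ◅ p) = stop , a ◅ p
  walk-split (_ ∷ [])    (a ◅ p) with walk-split [] p
  ... | q , r = a ◅ q , r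
  walk-split (_ ∷ b ∷ P) (a ◅ p) with walk-split (b ∷ P) p
  ... | q , r = a ◅ q , r

  walk-glue : ∀ {x p y q z} → Walk x p y → Walk y q z →
              ∃ λ w → Walk x w z × (∀ {v} → v ∈ w → v ∈ p ⊎ v ∈ q)
  walk-glue stop q = _ , q , inj₂
  walk-glue (a ◅ p) q with walk-glue p q
  ... | w , r , s = _ , a ◅ r ,
        λ { (here e) → inj₁ (here e)
          ; (there m) → map₁ there (s m) }

  loop-erase : ∀ {x w y} → Walk x w y → ∃ λ w′ → Walk x w′ y × Unique w′ × w′ ⊑ (_∈ w)
  loop-erase stop = _ , stop , singleton-unique , λ m → m
  loop-erase (_◅_ {x} a p) with loop-erase p
  ... | w′ , q , u , s with x ∈? w′
  ...   | no x∉ = _ , a ◅ q , cons-unique x∉ u ,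
                  λ { (here e) → here e ; (there m) → there (s m) }
  ...   | yes x∈ with ∈-∃++ x∈
  ...     | P , Q , refl = _ , proj₂ (walk-split P q) , proj₁ (proj₂ (unique-++⁻ P u)) ,
                           λ m → there (s (∈-++⁺ʳ P m))

  record Path (S : Pred (Fin n) 0ℓ) (x y : Fin n) : Set where
    constructor mkPath
    field
      verts  : List (Fin n)
      walk   : Walk x verts y
      unique : Unique verts
      within : verts ⊑ S

  open Path public

  walk⇒path : ∀ {S x w y} → Walk x w y → w ⊑ S → Path S x y
  walk⇒path p s with loop-erase p
  ... | w′ , q , u , t = mkPath w′ q u λ m → s (t m)

  path-sym : ∀ {S x y} → Path S x y → Path S y x
  path-sym (mkPath w p u s) = mkPath (reverse w) (walk-reverse p) (reverse-unique u) λ m → s (reverse⁻ m)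

  path-mono : ∀ {S S′ : Pred (Fin n) 0ℓ} {x y} → (∀ {v} → S v → S′ v) → Path S x y → Path S′ x y
  path-mono f (mkPath w p u s) = mkPath w p u λ m → f (s m)

  path-trans : ∀ {S x y z} → Path S x y → Path S y z → Path S x z
  path-trans p q with walk-glue (walk p) (walk q)
  ... | w , r , s = walk⇒path r λ m → [ within p , within q ] (s m)

  path-refl : ∀ {S : Pred (Fin n) 0ℓ} {x} → S x → Path S x x
  path-refl s = mkPath _ stop singleton-unique λ { (here refl) → s }

  path-edge : ∀ {S : Pred (Fin n) 0ℓ} {x y} → S x → S y → x ~ y → Path S x y
  path-edge s t a = walk⇒path (a ◅ stop) λ { (here refl) → s ; (there (here refl)) → t }

  -- The walk stops one step before `P`, so that `before` can serve as (part of) the interior of an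
  -- ear attached at `hit`.
  record FirstHit (P : Pred (Fin n) 0ℓ) (x : Fin n) (w : List (Fin n)) : Set where
    constructor firstHit
    field
      {before} : List (Fin n)
      {exit hit} : Fin n
      path   : Walk x before exit
      avoids : ∀ {v} → v ∈ before → v ∈ w × ¬ P v
      edge   : exit ~ hit
      isHit  : P hit
      inWalk : hit ∈ w

  first-hit : ∀ {P x w y} → Decidable P → Walk x w y → ¬ P x → P y → FirstHit P x w
  first-hit P? stop ¬px py = ⊥-elim (¬px py)
  first-hit P? (_◅_ {x} {y} a p) ¬px py with P? y
  ... | yes q = firstHit stop (λ { (here refl) → here refl , ¬px }) a q (there (walk-first p))
  ... | no ¬q with first-hit P? p ¬q py
  ...   | firstHit r s e h i = firstHit (a ◅ r)
            (λ { (here refl) → here refl , ¬px ; (there m) → there (proj₁ (s m)) , proj₂ (s m) })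
            e h (there i)

  private
    reroute : ∀ {x p f d₀ d d₁ g s y W e} → Walk x p f → f ~ d₀ → Walk d₀ d d₁ → d₁ ~ g → Walk g s y →
      Unique p → Unique d → Unique s → (∀ {v} → v ∈ p → v ∉ s) → (∀ {v} → v ∈ d → v ∉ W) →
      p ⊑ (_∈ W) → s ⊑ (_∈ W) → d ⊑ (_∈ e) → e ⊑ (_∈ d) →
      ∃ λ w → Walk x w y × Unique w × e ⊑ (_∈ w) × w ⊑ (λ v → v ∈ W ⊎ v ∈ e)
    reroute {p = p} {d = d} {W = W} {e} a i b j c ua ub uc ac bW aW cW be eb =
      p ++ d ++ _ , walk-++ a i (walk-++ b j c) ,
      ++-unique ua (++-unique ub uc λ m r → bW m (cW r))
        (λ m r → [ (λ q → bW q (aW m)) , ac m ] (∈-++⁻ d r)) ,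
      (λ m → ∈-++⁺ʳ p (∈-++⁺ˡ (eb m))) ,
      λ m → [ (λ q → inj₁ (aW q)) , (λ q → [ (λ r → inj₂ (be r)) , (λ r → inj₁ (cW r)) ] (∈-++⁻ d q)) ]
            (∈-++⁻ p m)

    pieces : ∀ {x y} P {f Q g R} → Walk x (P ++ f ∷ Q ++ g ∷ R) y → Unique (P ++ f ∷ Q ++ g ∷ R) →
      Walk x (P ++ f ∷ []) f × Walk g (g ∷ R) y × Unique (P ++ f ∷ []) × Unique (g ∷ R) ×
      (∀ {v} → v ∈ P ++ f ∷ [] → v ∉ g ∷ R) ×
      (P ++ f ∷ []) ⊑ (_∈ P ++ f ∷ Q ++ g ∷ R) × (g ∷ R) ⊑ (_∈ P ++ f ∷ Q ++ g ∷ R)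
    pieces P {f} {Q} {g} {R} p u =
      proj₁ (walk-split P p) , proj₂ (walk-split (f ∷ Q) (proj₂ (walk-split P p))) ,
      ++-unique (proj₁ uP) singleton-unique (λ { m (here refl) → proj₂ (proj₂ uP) m (here refl) }) ,
      proj₁ (proj₂ uQ) ,
      (λ m r → [ (λ q → proj₂ (proj₂ uP) q (there (∈-++⁺ʳ Q r)))
               , (λ { refl → head∉tail (proj₁ (proj₂ uP)) (∈-++⁺ʳ Q r) }) ] (∈-snoc⁻ P m)) ,
      (λ m → [ ∈-++⁺ˡ , (λ { refl → ∈-insert P }) ] (∈-snoc⁻ P m)) ,
      (λ m → ∈-++⁺ʳ P (there (∈-++⁺ʳ Q m)))
      where
      uP = unique-++⁻ P u
      uQ = unique-++⁻ Q (tail-unique (proj₁ (proj₂ uP)))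

  -- The stretch of `w` between `f` and `g` is replaced by `d`; if `g` comes before `f` on `w`, then
  -- `d` is traversed backwards.
  detour : ∀ {x w y f g d₀ d d₁} → Walk x w y → Unique w → f ∈ w → g ∈ w → f ≢ g →
           Walk d₀ d d₁ → Unique d → (∀ {v} → v ∈ d → v ∉ w) → f ~ d₀ → d₁ ~ g →
           ∃ λ w′ → Walk x w′ y × Unique w′ × d ⊑ (_∈ w′) × w′ ⊑ (λ v → v ∈ w ⊎ v ∈ d)
  detour p u f∈ g∈ f≢g δ uδ δ∉w f~ ~g with ordered f∈ g∈ f≢g
  ... | inj₁ (P , Q , R , refl) with pieces P p u
  ...   | a , c , ua , uc , ac , aW , cW =
          reroute a f~ δ ~g c ua uδ uc ac δ∉w aW cW (λ m → m) (λ m → m)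
  detour p u f∈ g∈ f≢g δ uδ δ∉w f~ ~g | inj₂ (P , Q , R , refl) with pieces P p u
  ...   | a , c , ua , uc , ac , aW , cW =
          reroute a (sym ~g) (walk-reverse δ) (sym f~) c ua (reverse-unique uδ) uc ac
            (λ m → δ∉w (reverse⁻ m)) aW cW reverse⁻ reverse⁺

  -- The deleted vertex `w` may lie outside `R`, which makes `R` itself connected. There is no lower
  -- bound on the size of `R`, so that a single edge qualifies as a starting point.
  TwoConn : Pred (Fin n) 0ℓ → Set
  TwoConn R = ∀ w {x y} → R x → R y → x ≢ w → y ≢ w → Path (λ v → R v × v ≢ w) x y

  -- The vertices lying on some path from x to y are closed under adjacency:
  -- a neighbour of such a vertex v reaches the path again avoiding v.
  path-through : ∀ {R x y k} → (∀ a b → ∃ λ o → o ≢ a × o ≢ b) → TwoConn R →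
                 x ≢ y → R x → R y → R k → Σ[ p ∈ Path R x y ] k ∈ verts p
  path-through {R} {x} {y} {k} fresh tc x≢y Rx Ry Rk =
    closed (walk c) (within c) start (walk-first (walk start))
    where
    conn : ∀ {a b} → R a → R b → Path R a b
    conn {a} {b} Ra Rb with fresh a b
    ... | o , o≢a , o≢b = path-mono proj₁ (tc o Ra Rb (λ e → o≢a (≡-sym e)) (λ e → o≢b (≡-sym e)))
    c = conn Rx Rk
    start = conn Rx Ry
    closed : ∀ {v w k} → Walk v w k → w ⊑ R → (p : Path R x y) → v ∈ verts p →
             Σ[ p ∈ Path R x y ] k ∈ verts p
    closed stop Rw p v∈ = p , v∈
    closed (_◅_ {v} {v′} a r) Rw p v∈ with v′ ∈? verts p
    ... | yes v′∈ = closed r (λ m → Rw (there m)) p v′∈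
    ... | no v′∉ = extend target
      where
      target : ∃ λ g → g ∈ verts p × g ≢ v
      target with x ≟ v
      ... | yes refl = y , walk-last (walk p) , λ e → x≢y (≡-sym e)
      ... | no x≢v = x , walk-first (walk p) , x≢v
      extend : (∃ λ g → g ∈ verts p × g ≢ v) → _
      extend (g , g∈ , g≢v)
        with tc v (Rw (there (walk-first r))) (within p g∈) (λ e → ~⇒≢ a (≡-sym e)) g≢v
      ... | q with first-hit (_∈? verts p) (walk q) v′∉ g∈
      ...   | firstHit s av e h i with loop-erase s
      ...     | d , δ , uδ , ds with detour (walk p) (unique p) v∈ h (λ e → proj₂ (within q i) (≡-sym e))
                                       δ uδ (λ m → proj₂ (av (ds m))) a e
      ...       | w′ , p′ , u′ , d⊆ , ⊆w =
                    closed r (λ m → Rw (there m))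
                      (mkPath w′ p′ u′ λ m → [ within p , (λ q∈ → proj₁ (within q (proj₁ (av (ds q∈))))) ] (⊆w m))
                      (d⊆ (walk-first δ))

  -- Wheels and twins

  ∈N⁺ : ∀ {v u} → v ~ u → u Sub.∈ N G v
  ∈N⁺ {v} = ∈-tabulate⁺ (adj? v)

  ∈N⁻ : ∀ {v u} → u Sub.∈ N G v → v ~ u
  ∈N⁻ {v} = ∈-tabulate⁻ (adj? v)

  length≤degree : ∀ {v l} → Unique l → l ⊑ (v ~_) → length l ≤ degree G v
  length≤degree u s = length≤∣p∣ u λ m → ∈N⁺ (s m)

  unique₃ : ∀ {a b c : Fin n} → a ≢ b → a ≢ c → b ≢ c → Unique (a ∷ b ∷ c ∷ [])
  unique₃ p q r = (p ∷ q ∷ []) ∷ (r ∷ []) ∷ [] ∷ []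

  private
    steps : ∀ {x w y} b → Walk x (b ∷ w) y → ∀ i → lookup (b ∷ w) (inject₁ i) ~ lookup (b ∷ w) (suc i)
    steps {w = c ∷ w} b (a ◅ p) zero    = subst (b ~_) (walk-head p) a
    steps {w = c ∷ w} b (a ◅ p) (suc i) = steps c p i

    ends : ∀ {x w y} b → Walk x (b ∷ w) y → lookup (b ∷ w) (fromℕ (length w)) ≡ y
    ends {w = []} b stop = refl
    ends {w = []} b (a ◅ ())
    ends {w = c ∷ w} b (a ◅ p) = ends c p

    -- A closed walk might be one edge traversed back and forth; the three distinct neighbours of
    -- `v` on `w` force the three vertices that `Cycle` demands.
    wheel′ : ∀ {x y v a b c} w → Walk x w y → y ~ x → Unique w → v ∉ w → a ∈ w → b ∈ w → c ∈ w →
             v ~ a → v ~ b → v ~ c → a ≢ b → a ≢ c → b ≢ c → W G v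
    wheel′ [] () _ _ _ _ _ _ _ _ _ _ _
    wheel′ (_ ∷ []) p _ _ _ (here refl) (here refl) _ _ _ _ ab _ _ = ⊥-elim (ab refl)
    wheel′ (_ ∷ _ ∷ []) p _ _ _ (here refl) (here refl) _ _ _ _ ab _ _ = ⊥-elim (ab refl)
    wheel′ (_ ∷ _ ∷ []) p _ _ _ (there (here refl)) (there (here refl)) _ _ _ _ ab _ _ = ⊥-elim (ab refl)
    wheel′ (_ ∷ _ ∷ []) p _ _ _ (here refl) (there (here refl)) (here refl) _ _ _ _ ac _ = ⊥-elim (ac refl)
    wheel′ (_ ∷ _ ∷ []) p _ _ _ (here refl) (there (here refl)) (there (here refl)) _ _ _ _ _ bc = ⊥-elim (bc refl)
    wheel′ (_ ∷ _ ∷ []) p _ _ _ (there (here refl)) (here refl) (here refl) _ _ _ _ _ bc = ⊥-elim (bc refl)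
    wheel′ (_ ∷ _ ∷ []) p _ _ _ (there (here refl)) (here refl) (there (here refl)) _ _ _ _ ac _ = ⊥-elim (ac refl)
    wheel′ {x} {y} {v} w@(w₀ ∷ w₁ ∷ w₂ ∷ r) p e u v∉ a∈ b∈ c∈ va vb vc ab ac bc = C , v∉C , 3≤
      where
      C : Cycle G
      C = record
        { m = length r ; vertex = lookup w ; injective = lookup-injective u
        ; step = steps w₀ p
        ; close = subst (_~ w₀) (≡-sym (ends w₀ p)) (subst (y ~_) (walk-head p) e) }
      ∈C⁺ : ∀ {z} → z ∈ w → z Sub.∈ V G C
      ∈C⁺ z∈ = ∈-tabulate⁺ (λ z → any? λ i → lookup w i ≟ z) (index z∈ , ≡-sym (lookup-index z∈))
      v∉C : v Sub.∉ V G C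
      v∉C m with ∈-tabulate⁻ (λ z → any? λ i → lookup w i ≟ z) m
      ... | i , e = v∉ (subst (_∈ w) e (∈-lookup i))
      3≤ : 3 ≤ ∣ N G v Sub.∩ V G C ∣
      3≤ = length≤∣p∣ (unique₃ ab ac bc)
        λ { (here refl) → x∈p∩q⁺ (∈N⁺ va , ∈C⁺ a∈)
          ; (there (here refl)) → x∈p∩q⁺ (∈N⁺ vb , ∈C⁺ b∈)
          ; (there (there (here refl))) → x∈p∩q⁺ (∈N⁺ vc , ∈C⁺ c∈) }

  wheel : ∀ {x w y v a b c} → Walk x w y → y ~ x → Unique w → v ∉ w → a ∈ w → b ∈ w → c ∈ w →
          v ~ a → v ~ b → v ~ c → a ≢ b → a ≢ c → b ≢ c → W G v
  wheel {w = w} = wheel′ w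

  twins : ∀ {a b x y z} → a ≢ b → ¬ a ~ b → x ≢ y → x ≢ z → y ≢ z →
          (∀ {v} → v ∈ x ∷ y ∷ z ∷ [] → a ~ v) → (∀ {v} → v ∈ x ∷ y ∷ z ∷ [] → b ~ v) →
          (∀ {v} → a ~ v → v ∈ x ∷ y ∷ z ∷ []) → (∀ {v} → b ~ v → v ∈ x ∷ y ∷ z ∷ []) → Twins G a b
  twins {a} {b} a≢b a≁b xy xz yz a⁺ b⁺ a⁻ b⁻ =
    a≢b , a≁b , three a⁺ a⁻ , three b⁺ b⁻ ,
    ⊆-antisym (λ m → ∈N⁺ (b⁺ (a⁻ (∈N⁻ m)))) (λ m → ∈N⁺ (a⁺ (b⁻ (∈N⁻ m))))
    where
    three : ∀ {v} → (∀ {u} → u ∈ _ → v ~ u) → (∀ {u} → v ~ u → u ∈ _) → degree G v ≡ 3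
    three v⁺ v⁻ = ≤-antisym (∣p∣≤length _ λ m → v⁻ (∈N⁻ m)) (length≤degree (unique₃ xy xz yz) v⁺)

  -- Ears

  -- Via x E y : the vertices of E, in order, are the interior of a walk from x to y.
  Via : Fin n → List (Fin n) → Fin n → Set
  Via x []      y = x ~ y
  Via x (z ∷ E) y = x ~ z × Via z E y

  -- On an ear `as ++ c ∷ bs` from `α` to `β`, the two neighbours of `c` are `lst α as` and
  -- `hd bs β`, also when `c` is the first or the last interior vertex.
  lst : Fin n → List (Fin n) → Fin n
  lst x []      = x
  lst x (z ∷ E) = lst z E

  hd : List (Fin n) → Fin n → Fin n
  hd []      y = y
  hd (z ∷ _) y = z

  via-split : ∀ {x y c} as {bs} → Via x (as ++ c ∷ bs) y → Via x as c × Via c bs y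
  via-split []       p = p
  via-split (_ ∷ as) (a , p) with via-split as p
  ... | q , r = (a , q) , r

  via-join : ∀ {x y c} as {bs} → Via x as c → Via c bs y → Via x (as ++ c ∷ bs) y
  via-join []       a       q = a , q
  via-join (_ ∷ as) (a , p) q = a , via-join as p q

  via-last : ∀ {x y} as → Via x as y → lst x as ~ y
  via-last []       a       = a
  via-last (_ ∷ as) (_ , p) = via-last as p

  via-head : ∀ {x y} bs → Via x bs y → x ~ hd bs y
  via-head []      a       = a
  via-head (_ ∷ _) (a , _) = a

  via-change-last : ∀ {x y t} as → Via x as y → lst x as ~ t → Via x as t
  via-change-last []       _       b = b
  via-change-last (_ ∷ as) (a , p) b = a , via-change-last as p b

  via-change-head : ∀ {x y t} bs → Via x bs y → t ~ hd bs y → Via t bs y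
  via-change-head []      _       b = b
  via-change-head (_ ∷ _) (_ , p) b = b , p

  walk⇒via : ∀ {α x w y β} → α ~ x → Walk x w y → y ~ β → Via α w β
  walk⇒via a stop    b = a , b
  walk⇒via a (c ◅ p) b = a , walk⇒via c p b

  via⇒walk : ∀ {x e E y} → Via x (e ∷ E) y → x ~ e × ∃ λ e′ → Walk e (e ∷ E) e′ × e′ ~ y
  via⇒walk {E = []}    (a , b) = a , _ , stop , b
  via⇒walk {E = _ ∷ _} (a , p) with via⇒walk p
  ... | c , e′ , q , b = a , e′ , c ◅ q , b

  via-reverse : ∀ {x y} as → Via x as y → Via y (reverse as) x
  via-reverse []       a       = sym a
  via-reverse (z ∷ as) (a , p) rewrite unfold-reverse z as = via-join (reverse as) (via-reverse as p) (sym a)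

  via-path : ∀ {S : Pred (Fin n) 0ℓ} {x y} as → Via x as y → S x → S y → as ⊑ S → Path S x y
  via-path []       a       Sx Sy s = path-edge Sx Sy a
  via-path (_ ∷ as) (a , p) Sx Sy s =
    path-trans (path-edge Sx (s (here refl)) a) (via-path as p (s (here refl)) Sy λ m → s (there m))

  infixl 5 _⊕_

  _⊕_ : Pred (Fin n) 0ℓ → List (Fin n) → Pred (Fin n) 0ℓ
  (R ⊕ E) v = R v ⊎ v ∈ E

  record Ear (R : Pred (Fin n) 0ℓ) (α : Fin n) (E : List (Fin n)) (β : Fin n) : Set where
    constructor mkEar
    field
      via      : Via α E β
      distinct : Unique E
      outside  : E ⊑ λ v → ¬ R v
      start∈   : R α
      end∈     : R β
      ends≢    : α ≢ β
      nonempty : E ≢ []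

  ear-reverse : ∀ {R α E β} → Ear R α E β → Ear R β (reverse E) α
  ear-reverse {E = E} (mkEar v u o s e d ne) =
    mkEar (via-reverse E v) (reverse-unique u) (λ m → o (reverse⁻ m)) e s (λ x → d (≡-sym x)) (nonempty E ne)
    where
    nonempty : ∀ E → E ≢ [] → reverse E ≢ []
    nonempty []      ne _ = ne refl
    nonempty (x ∷ E) ne eq with subst (x ∈_) eq (reverse⁺ {xs = x ∷ E} (here refl))
    ... | ()

  twoConn-mono : ∀ {R R′ : Pred (Fin n) 0ℓ} → (∀ {v} → R v → R′ v) → (∀ {v} → R′ v → R v) →
                 TwoConn R → TwoConn R′
  twoConn-mono f g tc w Rx Ry xw yw = path-mono (λ (r , ne) → f r , ne) (tc w (g Rx) (g Ry) xw yw)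

  -- Every remaining vertex of the ear reaches `R`: backwards to `α`, or forwards to `β` if `w` lies
  -- on the way back. As the ear has no repetitions and different ends, `w` cannot block both
  -- directions.
  ear-twoConn : ∀ {R α E β} → TwoConn R → Ear R α E β → TwoConn (R ⊕ E)
  ear-twoConn {R} {α} {E} {β} tc e w {x} {y} x∈ y∈ xw yw
    with to-R x∈ xw | to-R y∈ yw
    where
    open Ear e
    S : Pred (Fin n) 0ℓ
    S u = (R ⊕ E) u × u ≢ w
    to-R : ∀ {v} → (R ⊕ E) v → v ≢ w → ∃ λ d → R d × d ≢ w × Path S v d
    to-R (inj₁ r) ne = _ , r , ne , path-refl (inj₁ r , ne)
    to-R {v} (inj₂ m) ne with ∈-∃++ m
    ... | as , bs , refl with w ∈? as | w ≟ α
    ...   | no w∉ | no w≢ = α , start∈ , (λ eq → w≢ (≡-sym eq)) ,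
            path-sym (via-path as (proj₁ (via-split as via)) (inj₁ start∈ , λ eq → w≢ (≡-sym eq)) (inj₂ m , ne)
              λ q → inj₂ (∈-++⁺ˡ q) , λ { refl → w∉ q })
    ...   | yes w∈ | _ = right λ { (inj₁ q) → proj₂ (proj₂ (unique-++⁻ as distinct)) w∈ (there q)
                                 ; (inj₂ refl) → outside (∈-++⁺ˡ w∈) end∈ }
      where
      right : (w ∈ bs ⊎ w ≡ β → ⊥) → _
      right w∉ = β , end∈ , (λ eq → w∉ (inj₂ (≡-sym eq))) ,
        via-path bs (proj₂ (via-split as via)) (inj₂ m , ne) (inj₁ end∈ , λ eq → w∉ (inj₂ (≡-sym eq)))
          λ q → inj₂ (∈-++⁺ʳ as (there q)) , λ { refl → w∉ (inj₁ q) }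
    ...   | no _ | yes refl = right λ { (inj₁ q) → outside (∈-++⁺ʳ as (there q)) start∈ ; (inj₂ eq) → ends≢ eq }
      where
      right : (w ∈ bs ⊎ w ≡ β → ⊥) → _
      right w∉ = β , end∈ , (λ eq → w∉ (inj₂ (≡-sym eq))) ,
        via-path bs (proj₂ (via-split as via)) (inj₂ m , ne) (inj₁ end∈ , λ eq → w∉ (inj₂ (≡-sym eq)))
          λ q → inj₂ (∈-++⁺ʳ as (there q)) , λ { refl → w∉ (inj₁ q) }
  ... | d , Rd , dw , p | d′ , Rd′ , dw′ , p′ =
        path-trans p (path-trans (path-mono (λ (r , ne) → inj₁ r , ne) (tc w Rd Rd′ dw dw′)) (path-sym p′))

  walk⇒ear : ∀ {R α x w y β} → Walk x w y → Unique w → w ⊑ (λ v → ¬ R v) → α ~ x → y ~ β →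
             R α → R β → α ≢ β → Ear R α w β
  walk⇒ear p u o a b Rα Rβ ne = mkEar (walk⇒via a p b) u o Rα Rβ ne λ { refl → empty p }
    where
    empty : ∀ {x y} → ¬ Walk x [] y
    empty ()

  ear-wheel : ∀ {R α E β v a b c} → Ear R α E β → (p : Path R β α) → ¬ R v → v ∉ E →
              a ∈ verts p ++ E → b ∈ verts p ++ E → c ∈ verts p ++ E →
              v ~ a → v ~ b → v ~ c → a ≢ b → a ≢ c → b ≢ c → W G v
  ear-wheel {E = []} e = ⊥-elim (Ear.nonempty e refl)
  ear-wheel {E = x ∷ E} e p ¬Rv v∉ a∈ b∈ c∈ va vb vc ab ac bc with via⇒walk (Ear.via e)
  ... | αx , e′ , q , e′β = wheel (walk-++ (walk p) αx q) e′β
    (++-unique (unique p) (Ear.distinct e) λ m r → Ear.outside e r (within p m))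
    (λ m → [ (λ r → ¬Rv (within p r)) , v∉ ] (∈-++⁻ (verts p) m)) a∈ b∈ c∈ va vb vc ab ac bc

  -- Cycles and forests

  single-walk : ∀ {x w} → Walk x w x → Unique w → w ⊑ (_≡ x)
  single-walk stop u (here e) = e
  single-walk (a ◅ p) u m = ⊥-elim (head∉tail u (walk-last p))

  -- A nonempty set of minimum degree two within itself, which exists in `S` exactly when `S`
  -- contains a cycle. In this form it is evident that a vertex with at most one neighbour in `S` is
  -- not a member.
  record Core (S : Pred (Fin n) 0ℓ) : Set where
    constructor mkCore
    field
      members : List (Fin n)
      {some}  : Fin n
      some∈   : some ∈ members
      ⊑S      : members ⊑ S
      two     : ∀ {v} → v ∈ members → ∃₂ λ a b → a ∈ members × b ∈ members × a ≢ b × v ~ a × v ~ b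

  core-mono : ∀ {S S′ : Pred (Fin n) 0ℓ} → (∀ {v} → S v → S′ v) → Core S → Core S′
  core-mono f (mkCore l s i t) = mkCore l s (λ m → f (i m)) t

  walk-tail : ∀ {x b w y} → Walk x (x ∷ b ∷ w) y → Walk b (b ∷ w) y
  walk-tail (a ◅ p) with walk-head p
  ... | refl = p

  next : ∀ {x q Q y} → Walk x (x ∷ q ∷ Q) y → x ~ q × y ∈ q ∷ Q
  next (a ◅ p) with walk-head p
  ... | refl = a , walk-last p

  previous : ∀ {x p v} P → Walk x (p ∷ P ++ v ∷ []) v → ∃ λ a → a ∈ p ∷ P × a ~ v
  previous [] (_◅_ {x} a p) with walk-head p
  ... | refl = x , here refl , a
  previous (q ∷ P) (a ◅ p) with previous P p
  ... | b , m , e = b , there m , e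

  private
    ∈-pair⁻ : ∀ {z x y : Fin n} → z ∈ x ∷ y ∷ [] → z ≡ x ⊎ z ≡ y
    ∈-pair⁻ (here e)         = inj₁ e
    ∈-pair⁻ (there (here e)) = inj₂ e

  -- The third vertex `z` excludes a single edge traversed back and forth.
  cycle⇒core : ∀ {S : Pred (Fin n) 0ℓ} {x w y z} → Walk x w y → y ~ x → Unique w → z ∈ w → z ≢ x → z ≢ y →
               w ⊑ S → Core S
  cycle⇒core {x = x} {w} {y} {z} p yx u z∈ zx zy s = mkCore w z∈ s two
    where
    two : ∀ {v} → v ∈ w → ∃₂ λ a b → a ∈ w × b ∈ w × a ≢ b × v ~ a × v ~ b
    two v∈ with ∈-∃++ v∈
    two v∈ | P , Q , refl with walk-split P p
    two v∈ | [] , [] , refl | q , stop with walk-head p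
    ... | refl = ⊥-elim (~⇒≢ yx refl)
    two v∈ | [] , [] , refl | q , (_ ◅ ())
    two v∈ | [] , c ∷ [] , refl | q , r with walk-head p | walk-last p
    ... | refl | here refl = ⊥-elim (~⇒≢ yx refl)
    ... | refl | there (here refl) = ⊥-elim ([ zx , zy ] (∈-pair⁻ z∈))
    two v∈ | [] , c ∷ d ∷ Q , refl | q , r with walk-head p
    ... | refl = y , c , walk-last p , there (here refl) , y≢c , sym yx , proj₁ (next r)
      where
      y≢c : y ≢ c
      y≢c refl = head∉tail (tail-unique u) (proj₂ (next (walk-tail r)))
    two v∈ | e ∷ P , c ∷ Q , refl | q , r with previous P q
    ... | a , a∈ , av = a , c , ∈-++⁺ˡ a∈ , ∈-++⁺ʳ (e ∷ P) (there (here refl)) ,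
          (λ { refl → proj₂ (proj₂ (unique-++⁻ (e ∷ P) u)) a∈ (there (here refl)) }) , sym av , proj₁ (next r)
    two v∈ | e ∷ P , [] , refl | q , (_ ◅ ())
    two v∈ | e ∷ [] , [] , refl | q , stop with walk-head p
    ... | refl = ⊥-elim ([ zx , zy ] (∈-pair⁻ z∈))
    two v∈ | e ∷ f ∷ P , [] , refl | (_ ◅ q) , stop with walk-head p | previous P q
    ... | refl | a , a∈ , av = a , e , there (∈-++⁺ˡ a∈) , here refl ,
          (λ { refl → head∉tail u (∈-++⁺ˡ a∈) }) , sym av , yx

  -- The vertex p need not be adjacent to v, so a vertex without neighbours in S is a leaf too.
  Leaf : Pred (Fin n) 0ℓ → Fin n → Fin n → Set
  Leaf S v p = ∀ {u} → S u → v ~ u → u ≡ p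

  chord⇒core : ∀ {S : Pred (Fin n) 0ℓ} {x r w y u} → Walk x (x ∷ r ∷ w) y → Unique (x ∷ r ∷ w) → (x ∷ r ∷ w) ⊑ S →
               u ∈ w → x ~ u → Core S
  chord⇒core {x = x} {r} p un s u∈ xu with ∈-∃++ u∈
  ... | P , Q , refl = cycle⇒core {z = r} (proj₁ (walk-split (x ∷ r ∷ P) p)) (sym xu)
        (proj₁ (unique-++⁻ (x ∷ r ∷ P ++ _ ∷ []) (subst Unique (assoc (x ∷ r ∷ P)) un)))
        (there (here refl)) (λ { refl → head∉tail un (here refl) })
        (λ { refl → head∉tail (tail-unique un) u∈ })
        λ {v} m → s (subst (v ∈_) (≡-sym (assoc (x ∷ r ∷ P))) (∈-++⁺ˡ m))
    where
    assoc : ∀ xs {y : Fin n} {ys} → xs ++ y ∷ ys ≡ (xs ++ y ∷ []) ++ ys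
    assoc []       = refl
    assoc (_ ∷ xs) = cong (_ ∷_) (assoc xs)

  record Extension (S : Pred (Fin n) 0ℓ) (w : List (Fin n)) (y : Fin n) : Set where
    constructor mkExtension
    field
      front   : List (Fin n)
      {x′ p}  : Fin n
      walk′   : Walk x′ (front ++ w) y
      unique′ : Unique (front ++ w)
      within′ : (front ++ w) ⊑ S
      leaf    : Leaf S x′ p

  record Maximal (S : Pred (Fin n) 0ℓ) (w : List (Fin n)) : Set where
    constructor mkMaximal
    field
      {x y px py} : Fin n
      {list} : List (Fin n)
      walk   : Walk x list y
      unique : Unique list
      within : list ⊑ S
      ⊒w     : w ⊑ (_∈ list)
      leaf-x : Leaf S x px
      leaf-y : Leaf S y py

  record Branch (S : Pred (Fin n) 0ℓ) (s : Fin n) : Set where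
    constructor mkBranch
    field
      {tip p} : Fin n
      {list}  : List (Fin n)
      walk    : Walk tip list s
      unique  : Unique list
      within  : list ⊑ S
      tip≢s   : tip ≢ s
      leaf    : Leaf S tip p

  record TwoBranches (S : Pred (Fin n) 0ℓ) (s : Fin n) : Set where
    constructor mkBranches
    field
      {u v pu pv} : Fin n
      {list} : List (Fin n)
      walk   : Walk u list v
      unique : Unique list
      within : list ⊑ S
      s∈     : s ∈ list
      u≢s    : u ≢ s
      v≢s    : v ≢ s
      u≢v    : u ≢ v
      leaf-u : Leaf S u pu
      leaf-v : Leaf S v pv

  module _ {S : Pred (Fin n) 0ℓ} (S? : Decidable S) (forest : ¬ Core S) where

    private
      -- If all neighbours of `x` in `S` are already on the walk, only the second vertex of the walk
      -- can be among them, since any later one would be the end of a chord.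
      leaf-here : ∀ {x w y} → Walk x w y → Unique w → w ⊑ S →
                  (∀ {u} → S u → x ~ u → u ∈ w) → ∃ λ p → Leaf S x p
      leaf-here {x} stop u s all = x , λ Su e → ⊥-elim (single (all Su e) e)
        where
        single : ∀ {v} → v ∈ x ∷ [] → ¬ x ~ v
        single (here refl) e = ~⇒≢ e refl
      leaf-here {x} (_◅_ {w = r ∷ w} a p) u s all with walk-head p
      ... | refl = r , only
        where
        only : Leaf S x r
        only Su e with all Su e
        ... | here refl = ⊥-elim (~⇒≢ e refl)
        ... | there (here eq) = eq
        ... | there (there m) = ⊥-elim (forest (chord⇒core (a ◅ p) u s m e))

      -- The number `k` bounds how many vertices are still missing from the walk, so it decreases
      -- with each extension.
      extend′ : ∀ k {x w y} → n ≤ length w + k → Walk x w y → Unique w → w ⊑ S → Extension S w y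
      extend′ k {x} {w} le p u s with any? (λ v → S? v ×-dec adj? x v ×-dec ¬? (v ∈? w))
      ... | no none = mkExtension [] p u s (proj₂ (leaf-here p u s all))
        where
        all : ∀ {v} → S v → x ~ v → v ∈ w
        all {v} Sv e with v ∈? w
        ... | yes m = m
        ... | no ¬m = ⊥-elim (none (v , Sv , e , ¬m))
      extend′ zero {w = w} le p u s | yes (v , Sv , e , v∉) =
        ⊥-elim (<⇒≱ (s≤s (subst (n ≤_) (+-identityʳ _) le))
          (≤-trans (length≤∣p∣ {p = ⊤} (cons-unique v∉ u) (λ _ → ∈⊤)) (≤-reflexive (∣⊤∣≡n n))))
      extend′ (suc k) {w = w} le p u s | yes (v , Sv , e , v∉)
        with extend′ k (subst (n ≤_) (+-suc (length w) k) le) (sym e ◅ p) (cons-unique v∉ u)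
               (λ { (here refl) → Sv ; (there m) → s m })
      ... | mkExtension front q u′ s′ l = mkExtension (front ++ v ∷ [])
            (subst (λ l → Walk _ l _) eq q) (subst Unique eq u′) (λ m → s′ (subst (_ ∈_) (≡-sym eq) m)) l
        where
        assoc : ∀ xs → xs ++ v ∷ w ≡ (xs ++ v ∷ []) ++ w
        assoc []       = refl
        assoc (_ ∷ xs) = cong (_ ∷_) (assoc xs)
        eq = assoc front

    extend : ∀ {x w y} → Walk x w y → Unique w → w ⊑ S → Extension S w y
    extend {w = w} = extend′ n (m≤n+m n (length w))

    maximal : ∀ {x w y} → Walk x w y → Unique w → w ⊑ S → Maximal S w
    maximal p u s with extend p u s
    ... | mkExtension f q u′ s′ l with extend (walk-reverse q) (reverse-unique u′) (λ m → s′ (reverse⁻ m))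
    ...   | mkExtension g r u″ s″ l′ =
            mkMaximal r u″ s″ (λ m → ∈-++⁺ʳ g (reverse⁺ (∈-++⁺ʳ f m))) l′ l

    branch : ∀ {s m} → S s → s ~ m → S m → Branch S s
    branch {s} {m} Ss sm Sm = from (extend (sym sm ◅ stop)
      (cons-unique (λ { (here refl) → ~⇒≢ sm refl }) singleton-unique)
      (λ { (here refl) → Sm ; (there (here refl)) → Ss }))
      where
      from : Extension S (m ∷ s ∷ []) s → Branch S s
      from (mkExtension f q un w⊑ l) = mkBranch q un w⊑
        (λ { refl → ~⇒≢ sm (≡-sym (single-walk q un (∈-++⁺ʳ f (here refl)))) }) l

    two-branches : ∀ {s m m′} → S s → s ~ m → S m → s ~ m′ → S m′ → m ≢ m′ → TwoBranches S s
    two-branches {s} {m} {m′} Ss sm Sm sm′ Sm′ mm = from (maximal (sym sm ◅ sm′ ◅ stop)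
      (cons-unique (λ { (here refl) → ~⇒≢ sm refl ; (there (here refl)) → mm refl })
        (cons-unique (λ { (here refl) → ~⇒≢ sm′ refl }) singleton-unique))
      (λ { (here refl) → Sm ; (there (here refl)) → Ss ; (there (there (here refl))) → Sm′ }))
      where
      ≢s : ∀ {v p} → Leaf S v p → v ≢ s
      ≢s l refl = mm (trans (l Sm sm) (≡-sym (l Sm′ sm′)))
      from : Maximal S (m ∷ s ∷ m′ ∷ []) → TwoBranches S s
      from (mkMaximal q un w⊑ inc l l′) = mkBranches q un w⊑ (inc (there (here refl))) (≢s l) (≢s l′)
        (λ { refl → ≢s l (≡-sym (single-walk q un (inc (there (here refl))))) }) l l′

  module _ (conn : KConnected G 3) where

    -- Consequences of 3-connectivity

    fresh : ∀ a b c → ∃ λ o → o ∉ a ∷ b ∷ c ∷ []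
    fresh a b c with any? (λ o → ¬? (o ∈? a ∷ b ∷ c ∷ []))
    ... | yes p = p
    ... | no ¬p = ⊥-elim (<⇒≱ (proj₁ conn)
      (subst (_≤ 3) (∣⊤∣≡n n) (∣p∣≤length (a ∷ b ∷ c ∷ []) {⊤} λ {v} _ → stable v)))
      where
      stable : ∀ v → v ∈ a ∷ b ∷ c ∷ []
      stable v with v ∈? a ∷ b ∷ c ∷ []
      ... | yes m = m
      ... | no ¬m = ⊥-elim (¬p (v , ¬m))

    fresh₂ : ∀ a b → ∃ λ o → o ≢ a × o ≢ b
    fresh₂ a b with fresh a b b
    ... | o , o∉ = o , (λ e → o∉ (here e)) , λ e → o∉ (there (here e))

    ∣pair∣<3 : ∀ (a b : Fin n) → ∣ ⁅ a ⁆ ∪ₛ ⁅ b ⁆ ∣ < 3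
    ∣pair∣<3 a b = s≤s (∣p∣≤length (a ∷ b ∷ []) λ m →
      [ (λ r → here (x∈⁅y⁆⇒x≡y a r)) , (λ r → there (here (x∈⁅y⁆⇒x≡y b r))) ] (x∈p∪q⁻ ⁅ a ⁆ ⁅ b ⁆ m))

    ∉pair : ∀ {v a b : Fin n} → v ≢ a → v ≢ b → v Sub.∉ ⁅ a ⁆ ∪ₛ ⁅ b ⁆
    ∉pair {a = a} {b} va vb m =
      [ (λ r → va (x∈⁅y⁆⇒x≡y a r)) , (λ r → vb (x∈⁅y⁆⇒x≡y b r)) ] (x∈p∪q⁻ ⁅ a ⁆ ⁅ b ⁆ m)

    ∉pairˡ : ∀ {v a b : Fin n} → v Sub.∉ ⁅ a ⁆ ∪ₛ ⁅ b ⁆ → v ≢ a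
    ∉pairˡ {a = a} v∉ refl = v∉ (x∈p∪q⁺ (inj₁ (x∈⁅x⁆ a)))

    ∉pairʳ : ∀ {v a b : Fin n} → v Sub.∉ ⁅ a ⁆ ∪ₛ ⁅ b ⁆ → v ≢ b
    ∉pairʳ {b = b} v∉ refl = v∉ (x∈p∪q⁺ (inj₂ (x∈⁅x⁆ b)))

    private
      star : ∀ a b {x y} → x ≢ a → x ≢ b → y ≢ a → y ≢ b → Star (AdjOutside G (⁅ a ⁆ ∪ₛ ⁅ b ⁆)) x y
      star a b xa xb ya yb = proj₂ conn (⁅ a ⁆ ∪ₛ ⁅ b ⁆) (∣pair∣<3 a b) _ _ (∉pair xa xb) (∉pair ya yb)

    path-avoiding : ∀ a b {x y} → x ≢ a → x ≢ b → y ≢ a → y ≢ b → Path (λ v → v ≢ a × v ≢ b) x y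
    path-avoiding a b xa xb ya yb = go (xa , xb) (star a b xa xb ya yb)
      where
      go : ∀ {x y} → x ≢ a × x ≢ b → Star (AdjOutside G (⁅ a ⁆ ∪ₛ ⁅ b ⁆)) x y → Path (λ v → v ≢ a × v ≢ b) x y
      go s ε = path-refl s
      go s ((_ , v∉ , e) ◅ˢ r) = path-trans (path-edge s t e) (go t r)
        where t = ∉pairˡ v∉ , ∉pairʳ v∉

    private
      neighbour-avoiding : ∀ {v} a b → v ≢ a → v ≢ b → ∃ λ u → v ~ u × u ≢ a × u ≢ b
      neighbour-avoiding {v} a b va vb with fresh a b v
      ... | o , o∉ with star a b va vb (λ e → o∉ (here e)) (λ e → o∉ (there (here e)))
      ...   | ε = ⊥-elim (o∉ (there (there (here refl))))
      ...   | (_ , u∉ , e) ◅ˢ _ = _ , e , ∉pairˡ u∉ , ∉pairʳ u∉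

    -- Minimum degree three, in the form in which it is applied. A vertex to be deleted must differ
    -- from `v`, whence the case distinction; an excluded vertex equal to `v` costs nothing, because
    -- `v` is not its own neighbour.
    other-neighbour : ∀ v a b → ∃ λ u → v ~ u × u ≢ a × u ≢ b
    other-neighbour v a b with v ≟ a | v ≟ b
    ... | no va | no vb = neighbour-avoiding a b va vb
    ... | yes refl | no vb with neighbour-avoiding b b vb vb
    ...   | u , e , ub , _ = u , e , (λ { refl → ~⇒≢ e refl }) , ub
    other-neighbour v a b | no va | yes refl with neighbour-avoiding a a va va
    ...   | u , e , ua , _ = u , e , ua , λ { refl → ~⇒≢ e refl }
    other-neighbour v a b | yes refl | yes refl with fresh₂ v v
    ...   | o , ov , _ with neighbour-avoiding o o (λ e → ov (≡-sym e)) (λ e → ov (≡-sym e))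
    ...     | u , e , _ = u , e , (λ { refl → ~⇒≢ e refl }) , λ { refl → ~⇒≢ e refl }

    TwoNeighbours : Fin n → Fin n → Set
    TwoNeighbours v a = ∃₂ λ u u′ → v ~ u × u ≢ a × v ~ u′ × u′ ≢ a × u ≢ u′

    two-neighbours : ∀ v a → TwoNeighbours v a
    two-neighbours v a with other-neighbour v a a
    ... | u , vu , ua , _ with other-neighbour v a u
    ...   | u′ , vu′ , u′a , uu = u , u′ , vu , ua , vu′ , u′a , λ eq → uu (≡-sym eq)

    delete-twoConn : ∀ a → TwoConn (_≢ a)
    delete-twoConn a w xa ya xw yw = path-avoiding a w xa xw ya yw

    through : ∀ {R x y k} → TwoConn R → x ≢ y → R x → R y → R k → Σ[ p ∈ Path R x y ] k ∈ verts p
    through = path-through fresh₂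

    -- The graph without `v` is 2-connected, so a path from `a` to `b` in it can be led through a
    -- third neighbour of `v`; the edge between `a` and `b` closes it.
    triangle-centre : ∀ {v a b} → v ~ a → v ~ b → a ~ b → W G v
    triangle-centre {v} {a} {b} va vb ab with other-neighbour v a b
    ... | c , vc , ca , cb with through (delete-twoConn v) (~⇒≢ ab) (λ e → ~⇒≢ va (≡-sym e))
                                  (λ e → ~⇒≢ vb (≡-sym e)) (λ e → ~⇒≢ vc (≡-sym e))
    ...   | p , c∈ = wheel (walk p) (sym ab) (unique p) (λ m → within p m refl)
                       (walk-first (walk p)) (walk-last (walk p)) c∈ va vb vc
                       (~⇒≢ ab) (λ e → ca (≡-sym e)) (λ e → cb (≡-sym e))

    -- A walk from `f` first meets `D` in some `α`, and a walk from `f` avoiding `α` meets `D`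
    -- elsewhere, in `β`. Their parts outside `D` are joined at `f`.
    ear-exists : ∀ {D d₁ d₂ f} → Decidable D → D d₁ → D d₂ → d₁ ≢ d₂ → ¬ D f →
                 ∃ λ α → ∃ λ E → ∃ λ β → Ear D α E β
    ear-exists {D} {d₁} {d₂} {f} D? Dd₁ Dd₂ ne ¬Df
      with fresh₂ f d₁
    ... | o , of , od with first-hit D? (walk (path-avoiding o o
                             (λ e → of (≡-sym e)) (λ e → of (≡-sym e)) (λ e → od (≡-sym e)) (λ e → od (≡-sym e)))) ¬Df Dd₁
    ...   | firstHit {hit = α} p av e Dα _ with target
      where
      target : ∃ λ d → D d × d ≢ α
      target with d₁ ≟ α
      ... | no h = d₁ , Dd₁ , h
      ... | yes refl = d₂ , Dd₂ , λ h → ne (≡-sym h)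
    ...     | d , Dd , dα with path-avoiding α α (λ { refl → ¬Df Dα }) (λ { refl → ¬Df Dα }) dα dα
    ...       | r with first-hit D? (walk r) ¬Df Dd
    ...         | firstHit {hit = β} p′ av′ e′ Dβ i with walk-glue (walk-reverse p) p′
    ...           | w , q , ws with loop-erase q
    ...             | w′ , q′ , u , ws′ = α , w′ , β ,
      walk⇒ear q′ u (λ m → [ (λ h → proj₂ (av (reverse⁻ h))) , (λ h → proj₂ (av′ h)) ] (ws (ws′ m)))
        (sym e) e′ Dα Dβ (λ h → proj₁ (within r i) (≡-sym h))

    -- The neighbour `z` may lie anywhere in `R`, because the path closing the ear inside `R` can be
    -- led through it.
    ear-wheel-at : ∀ {R α E β v a b z} → TwoConn R → Ear R α E β → R z → ¬ R v → v ∉ E →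
                   a ∈ E ⊎ a ≡ α → b ∈ E → v ~ a → v ~ b → v ~ z → a ≢ b → a ≢ z → W G v
    ear-wheel-at {R} {α} {E} {β} {v} {a} {b} {z} tc e Rz ¬Rv v∉ a∈ b∈ va vb vz ab az
      with through tc (λ eq → Ear.ends≢ e (≡-sym eq)) (Ear.end∈ e) (Ear.start∈ e) Rz
    ... | p , z∈ = ear-wheel e p ¬Rv v∉ ([ ∈-++⁺ʳ (verts p) , (λ { refl → ∈-++⁺ˡ (walk-last (walk p)) }) ] a∈)
                     (∈-++⁺ʳ (verts p) b∈) (∈-++⁺ˡ z∈) va vb vz ab az λ { refl → Ear.outside e b∈ Rz }

    private
      inner-neighbours : ∀ {x w y c} → Walk x w y → Unique w → c ∈ w → c ≢ x → c ≢ y →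
                         ∃₂ λ a b → a ∈ w × b ∈ w × a ≢ b × c ~ a × c ~ b
      inner-neighbours p u c∈ cx cy with ∈-∃++ c∈
      inner-neighbours p u c∈ cx cy | P , Q , refl with walk-split P p
      inner-neighbours p u c∈ cx cy | [] , Q , refl | q , r = ⊥-elim (cx (≡-sym (walk-head p)))
      inner-neighbours p u c∈ cx cy | e ∷ P , [] , refl | q , stop = ⊥-elim (cy refl)
      inner-neighbours p u c∈ cx cy | e ∷ P , [] , refl | q , (_ ◅ ())
      inner-neighbours p u c∈ cx cy | e ∷ P , d ∷ Q , refl | q , r with previous P q
      ... | a , a∈ , ac = a , d , ∈-++⁺ˡ a∈ , ∈-++⁺ʳ (e ∷ P) (there (here refl)) ,
            (λ { refl → proj₂ (proj₂ (unique-++⁻ (e ∷ P) u)) a∈ (there (here refl)) }) , sym ac , proj₁ (next r)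

    -- A path inside R through c passes through both neighbours of c in R.
    ear-wheel-through : ∀ {R α L β c y z v s} → TwoConn R → R c → (∀ {u} → R u → c ~ u → u ≡ y ⊎ u ≡ z) →
      Ear R α L β → c ≢ α → c ≢ β → ¬ R v → v ∉ L → R y → R z → y ≢ z → s ∈ L → v ~ y → v ~ z → v ~ s → W G v
    ear-wheel-through {R} {c = c} {y} {z} tc Rc nc e cα cβ ¬Rv v∉ Ry Rz yz s∈ vy vz vs
      with through tc (λ eq → Ear.ends≢ e (≡-sym eq)) (Ear.end∈ e) (Ear.start∈ e) Rc
    ... | p , c∈ with inner-neighbours (walk p) (unique p) c∈ cβ cα
    ...   | a , b , a∈ , b∈ , ab , ca , cb = both (nc (within p a∈) ca) (nc (within p b∈) cb)
      where
      conclude : y ∈ verts p → z ∈ verts p → W G _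
      conclude y∈ z∈ = ear-wheel e p ¬Rv v∉ (∈-++⁺ˡ y∈) (∈-++⁺ˡ z∈) (∈-++⁺ʳ (verts p) s∈) vy vz vs yz
        (λ { refl → Ear.outside e s∈ Ry }) (λ { refl → Ear.outside e s∈ Rz })
      both : a ≡ y ⊎ a ≡ z → b ≡ y ⊎ b ≡ z → W G _
      both (inj₁ refl) (inj₁ refl) = ⊥-elim (ab refl)
      both (inj₂ refl) (inj₂ refl) = ⊥-elim (ab refl)
      both (inj₁ refl) (inj₂ refl) = conclude a∈ b∈
      both (inj₂ refl) (inj₁ refl) = conclude b∈ a∈

    segment : ∀ {x w y u v} → Walk x w y → Unique w → u ∈ w → v ∈ w → u ≢ v →
              ∃ λ w′ → Walk u w′ v × Unique w′ × w′ ⊑ (_∈ w)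
    segment {w = w} p un u∈ v∈ uv with ordered u∈ v∈ uv
    ... | inj₁ (P , Q , R , refl) with loop-erase (proj₁ (walk-split (_ ∷ Q) (proj₂ (walk-split P p))))
    ...   | w′ , q , un′ , s = w′ , q , un′ , λ m → ∈-++⁺ʳ P (sub (s m))
        where
        sub : (_ ∷ Q ++ _ ∷ []) ⊑ (_∈ _ ∷ Q ++ _ ∷ R)
        sub m = [ ∈-++⁺ˡ , (λ { refl → ∈-insert (_ ∷ Q) }) ] (∈-snoc⁻ (_ ∷ Q) m)
    segment p un u∈ v∈ uv | inj₂ (P , Q , R , refl) with loop-erase (proj₁ (walk-split (_ ∷ Q) (proj₂ (walk-split P p))))
    ...   | w′ , q , un′ , s = reverse w′ , walk-reverse q , reverse-unique un′ , λ m → ∈-++⁺ʳ P (sub (s (reverse⁻ m)))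
        where
        sub : (_ ∷ Q ++ _ ∷ []) ⊑ (_∈ _ ∷ Q ++ _ ∷ R)
        sub m = [ ∈-++⁺ˡ , (λ { refl → ∈-insert (_ ∷ Q) }) ] (∈-snoc⁻ (_ ∷ Q) m)

    apex⇒core : ∀ {S : Pred (Fin n) 0ℓ} {x w y u v c} → Walk x w y → Unique w → w ⊑ S → S c → c ∉ w →
                u ∈ w → v ∈ w → u ≢ v → c ~ u → c ~ v → Core S
    apex⇒core p un s Sc c∉ u∈ v∈ uv cu cv with segment p un u∈ v∈ uv
    ... | w′ , q , un′ , s′ = cycle⇒core (cu ◅ q) (sym cv) (cons-unique (λ m → c∉ (s′ m)) un′)
          (there (walk-first q)) (λ { refl → c∉ u∈ }) uv
          λ { (here refl) → Sc ; (there m) → s (s′ m) }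

    -- Modifications of ears

    module _ {D : Pred (Fin n) 0ℓ} where

      private
        Fits : List (Fin n) → List (Fin n) → Set
        Fits N E = Unique N × N ⊑ (λ v → ¬ D v) × (∀ {v} → v ∈ N → v ∉ E)

      fits-[] : ∀ {E} → Fits [] E
      fits-[] = [] , (λ ()) , λ ()

      fits-[_] : ∀ {t E} → ¬ D t → t ∉ E → Fits (t ∷ []) E
      fits-[_] ¬Dt t∉ = singleton-unique , (λ { (here refl) → ¬Dt }) , λ { (here refl) → t∉ }

      private
        mid≢[] : ∀ P {g : Fin n} {R} → P ++ g ∷ R ≢ []
        mid≢[] []      ()
        mid≢[] (_ ∷ _) ()

      -- This and the next two lemmas replace an initial, final or middle stretch `Q` of an ear by
      -- new vertices `N`. For a shortest ear the result is not shorter, and the `length` lemmas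
      -- below turn this into a bound of the length of `Q` by that of `N`.
      reroute-start : ∀ {α α′ β g} Q N {R} → Ear D α (Q ++ g ∷ R) β → D α′ → α′ ≢ β →
                      Via α′ N g → Fits N (Q ++ g ∷ R) → Ear D α′ (N ++ g ∷ R) β
      reroute-start Q N (mkEar v u o s e d _) Dα′ d′ vN (uN , oN , dN) = mkEar
        (via-join N vN (proj₂ (via-split Q v)))
        (++-unique uN (proj₁ (proj₂ (unique-++⁻ Q u))) λ m r → dN m (∈-++⁺ʳ Q r))
        (λ m → [ oN , (λ r → o (∈-++⁺ʳ Q r)) ] (∈-++⁻ N m)) Dα′ e d′ (mid≢[] N)

      reroute-end : ∀ {α β β′ f} P {Q} N → Ear D α (P ++ f ∷ Q) β → D β′ → α ≢ β′ →
                    Via f N β′ → Fits N (P ++ f ∷ Q) → Ear D α (P ++ f ∷ N) β′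
      reroute-end P {Q} N (mkEar v u o s e d _) Dβ′ d′ vN (uN , oN , dN) = mkEar
        (via-join P (proj₁ (via-split P v)) vN)
        (++-unique (proj₁ uP) (cons-unique (λ m → dN m (∈-insert P)) uN)
          λ { m (here refl) → proj₂ (proj₂ uP) m (here refl) ; m (there r) → dN r (∈-++⁺ˡ m) })
        (λ m → [ (λ r → o (∈-++⁺ˡ r)) , [ (λ { refl → o (∈-insert P) }) , oN ] ] (∈-mid⁻ P m)) s Dβ′ d′ (mid≢[] P)
        where uP = unique-++⁻ P u

      reroute-middle : ∀ {α β f g} P Q N {R} → Ear D α (P ++ f ∷ Q ++ g ∷ R) β →
                       Via f N g → Fits N (P ++ f ∷ Q ++ g ∷ R) → Ear D α (P ++ f ∷ N ++ g ∷ R) β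
      reroute-middle {f = f} {g} P Q N {R} (mkEar v u o s e d _) vN (uN , oN , dN) = mkEar
        (via-join P (proj₁ (via-split P v)) (via-join N vN (proj₂ (via-split Q (proj₂ (via-split P v))))))
        (++-unique (proj₁ uP)
          (cons-unique (λ m → [ (λ r → dN r (∈-insert P)) , (λ r → head∉tail (proj₁ (proj₂ uP)) (∈-++⁺ʳ Q r)) ] (∈-++⁻ N m))
            (++-unique uN (proj₁ (proj₂ uQ)) λ m r → dN m (∈-++⁺ʳ P (there (∈-++⁺ʳ Q r)))))
          λ { m (here refl) → proj₂ (proj₂ uP) m (here refl)
            ; m (there r) → [ (λ q → dN q (∈-++⁺ˡ m))
                            , (λ q → proj₂ (proj₂ uP) m (there (∈-++⁺ʳ Q q))) ] (∈-++⁻ N r) })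
        (λ m → [ (λ r → o (∈-++⁺ˡ r)) , [ (λ { refl → o (∈-insert P) })
               , (λ r → [ oN , (λ q → o (∈-++⁺ʳ P (there (∈-++⁺ʳ Q q)))) ] (∈-++⁻ N r)) ] ] (∈-mid⁻ P m))
        s e d (mid≢[] P)
        where
        uP = unique-++⁻ P u
        uQ = unique-++⁻ Q (tail-unique (proj₁ (proj₂ uP)))

      swap-vertex : ∀ {α β c t} as bs → Ear D α (as ++ c ∷ bs) β → t ~ lst α as → t ~ hd bs β →
                    ¬ D t → t ∉ as ++ c ∷ bs → Ear D α (as ++ t ∷ bs) β
      swap-vertex as bs (mkEar v u o s e d _) ty tz ¬Dt t∉ = mkEar
        (via-join as (via-change-last as (proj₁ (via-split as v)) (sym ty))
                     (via-change-head bs (proj₂ (via-split as v)) tz))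
        (++-unique (proj₁ ua) (cons-unique (λ m → t∉ (∈-++⁺ʳ as (there m))) (tail-unique (proj₁ (proj₂ ua))))
          λ { m (here refl) → t∉ (∈-++⁺ˡ m) ; m (there r) → proj₂ (proj₂ ua) m (there r) })
        (λ m → [ (λ r → o (∈-++⁺ˡ r)) , [ (λ { refl → ¬Dt }) , (λ r → o (∈-++⁺ʳ as (there r))) ] ] (∈-mid⁻ as m))
        s e d (mid≢[] as)
        where ua = unique-++⁻ as u

    lst-snoc : ∀ x as {y} → lst x (as ++ y ∷ []) ≡ y
    lst-snoc x []       = refl
    lst-snoc x (a ∷ as) = lst-snoc a as

    lst∈ : ∀ x as → lst x as ≡ x ⊎ lst x as ∈ as
    lst∈ x []       = inj₁ refl
    lst∈ x (a ∷ as) = inj₂ ([ here , there ]′ (lst∈ a as))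

    hd∈ : ∀ bs y → hd bs y ≡ y ⊎ hd bs y ∈ bs
    hd∈ []      y = inj₁ refl
    hd∈ (b ∷ _) y = inj₂ (here refl)

    length-middle : ∀ (P : List (Fin n)) {f} Q N R → length (P ++ f ∷ Q ++ R) ≤ length (P ++ f ∷ N ++ R) → length Q ≤ length N
    length-middle [] Q N R (s≤s le) rewrite length-++ Q {R} | length-++ N {R} = +-cancelʳ-≤ (length R) (length Q) (length N) le
    length-middle (_ ∷ P) Q N R (s≤s le) = length-middle P Q N R le

    length-start : ∀ (Q N R : List (Fin n)) → length (Q ++ R) ≤ length (N ++ R) → length Q ≤ length N
    length-start Q N R le rewrite length-++ Q {R} | length-++ N {R} = +-cancelʳ-≤ (length R) (length Q) (length N) le

    length-end : ∀ (P : List (Fin n)) {f} Q N → length (P ++ f ∷ Q) ≤ length (P ++ f ∷ N) → length Q ≤ length N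
    length-end []      Q N (s≤s le) = le
    length-end (_ ∷ P) Q N (s≤s le) = length-end P Q N le

    module _ (awf : AlmostWheelFree G) where

      -- Centres of wheels

      centre-degree : ∀ {v} → W G v → degree G v ≡ 3
      centre-degree = go awf
        where
        go : AlmostWheelFree G → ∀ {v} → W G v → degree G v ≡ 3
        go (inj₁ none) w = ⊥-elim (none _ w)
        go (inj₂ (inj₁ (u , W≐ , d))) w with proj₁ W≐ w
        ... | refl = d
        go (inj₂ (inj₂ (u , u′ , W≐ , _ , d , d′))) w with proj₁ W≐ w
        ... | inj₁ refl = d
        ... | inj₂ refl = d′

      centres-adjacent : ∀ {v w} → W G v → W G w → v ≢ w → v ~ w
      centres-adjacent = go awf
        where
        go : AlmostWheelFree G → ∀ {v w} → W G v → W G w → v ≢ w → v ~ w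
        go (inj₁ none) p q v≢w = ⊥-elim (none _ p)
        go (inj₂ (inj₁ (u , W≐ , d))) p q v≢w =
          ⊥-elim (v≢w (trans (≡-sym (proj₁ W≐ p)) (proj₁ W≐ q)))
        go (inj₂ (inj₂ (u , u′ , W≐ , e , _))) p q v≢w with proj₁ W≐ p | proj₁ W≐ q
        ... | inj₁ refl | inj₁ refl = ⊥-elim (v≢w refl)
        ... | inj₁ refl | inj₂ refl = e
        ... | inj₂ refl | inj₁ refl = sym e
        ... | inj₂ refl | inj₂ refl = ⊥-elim (v≢w refl)

      no-three-centres : ∀ {a b c} → W G a → W G b → W G c → a ≢ b → a ≢ c → b ≢ c → ⊥
      no-three-centres = go awf
        where
        go : AlmostWheelFree G → ∀ {a b c} → W G a → W G b → W G c → a ≢ b → a ≢ c → b ≢ c → ⊥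
        go (inj₁ none) p q r ab ac bc = none _ p
        go (inj₂ (inj₁ (u , W≐ , d))) p q r ab ac bc = ab (trans (≡-sym (proj₁ W≐ p)) (proj₁ W≐ q))
        go (inj₂ (inj₂ (u , u′ , W≐ , _))) p q r ab ac bc with proj₁ W≐ p | proj₁ W≐ q | proj₁ W≐ r
        ... | inj₁ refl | inj₁ refl | _         = ab refl
        ... | inj₂ refl | inj₂ refl | _         = ab refl
        ... | inj₁ refl | inj₂ _    | inj₁ refl = ac refl
        ... | inj₁ _    | inj₂ refl | inj₂ refl = bc refl
        ... | inj₂ _    | inj₁ refl | inj₁ refl = bc refl
        ... | inj₂ refl | inj₁ _    | inj₂ refl = ac refl

      triangle-free : ∀ {a b c} → a ~ b → a ~ c → b ~ c → ⊥
      triangle-free ab ac bc = no-three-centres (triangle-centre ab ac bc)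
        (triangle-centre (sym ab) bc ac) (triangle-centre (sym ac) (sym bc) ab)
        (~⇒≢ ab) (~⇒≢ ac) (~⇒≢ bc)

      degree≥4⇒¬centre : ∀ {v a b c d} → v ~ a → v ~ b → v ~ c → v ~ d →
        a ≢ b → a ≢ c → a ≢ d → b ≢ c → b ≢ d → c ≢ d → ¬ W G v
      degree≥4⇒¬centre va vb vc vd ab ac ad bc bd cd w = <⇒≱ {3} ≤-refl
        (≤-trans (length≤degree ((ab ∷ ac ∷ ad ∷ []) ∷ unique₃ bc bd cd)
          λ { (here refl) → va ; (there (here refl)) → vb
            ; (there (there (here refl))) → vc ; (there (there (there (here refl)))) → vd })
          (≤-reflexive (centre-degree w)))

      ⊕-dec : ∀ {D : Pred (Fin n) 0ℓ} → Decidable D → ∀ E → Decidable (D ⊕ E)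
      ⊕-dec D? E v = D? v ⊎-dec (v ∈? E)

      -- Leaves outside a maximal 2-connected subgraph and an ear

      module _ {D : Pred (Fin n) 0ℓ} (D? : Decidable D) (tc : TwoConn D)
        (max : ∀ {α E β} → Ear D α E β → ¬ Core (λ v → ¬ (D ⊕ E) v)) where

        module AtLeaf {α E β} (e : Ear D α E β) {t s} (¬Rt : ¬ (D ⊕ E) t) (¬Rs : ¬ (D ⊕ E) s) (ts : t ~ s)
          (leaf : Leaf (λ v → ¬ (D ⊕ E) v) t s) where

          R = D ⊕ E

          T : Pred (Fin n) 0ℓ
          T v = ¬ R v × v ≢ t

          T? : Decidable T
          T? v = ¬? (⊕-dec D? E v) ×-dec ¬? (v ≟ t)

          forest : ¬ Core T
          forest core = max e (core-mono proj₁ core)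

          Ts : T s
          Ts = ¬Rs , λ eq → ~⇒≢ ts (≡-sym eq)

          t~T : ∀ {v} → T v → t ~ v → v ≡ s
          t~T (¬Rv , _) = leaf ¬Rv

          classify : ∀ u → R u ⊎ u ≡ t ⊎ T u
          classify u with ⊕-dec D? E u | u ≟ t
          ... | yes r | _     = inj₁ r
          ... | no _  | yes p = inj₂ (inj₁ p)
          ... | no r  | no p  = inj₂ (inj₂ (r , p))

          exit : ∀ {v p} b → T v → v ≢ s → Leaf T v p → ∃ λ a → v ~ a × R a × a ≢ b
          exit {v} {p} b Tv vs l with other-neighbour v p b
          ... | a , va , ap , ab with classify a
          ...   | inj₁ r = a , va , r , ab
          ...   | inj₂ (inj₁ refl) = ⊥-elim (vs (t~T Tv (sym va)))
          ...   | inj₂ (inj₂ Ta) = ⊥-elim (ap (l Ta va))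

          two-exits : ∀ {v p} → T v → v ≢ s → Leaf T v p →
                      ∃₂ λ a b → v ~ a × v ~ b × R a × R b × a ≢ b
          two-exits {v} Tv vs l = from (exit s Tv vs l)
            where
            from : (∃ λ a → v ~ a × R a × a ≢ s) → ∃₂ λ a b → v ~ a × v ~ b × R a × R b × a ≢ b
            from (a , va , Ra , _) with exit a Tv vs l
            ... | b , vb , Rb , ba = a , b , va , vb , Ra , Rb , λ eq → ba (≡-sym eq)

          leaf-T⇒leaf : ∀ {v p} → T v → v ≢ s → Leaf T v p → Leaf (λ u → ¬ R u) v p
          leaf-T⇒leaf Tv vs l {u} ¬Ru vu with u ≟ t
          ... | yes refl = ⊥-elim (vs (t~T Tv (sym vu)))
          ... | no ut = l (¬Ru , ut) vu

          -- A common frame for ears with one, two and three vertices: `x` is a vertex of the ear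
          -- adjacent to `t`, and `P` says how a leaf of `T` not adjacent to `x` attaches instead.
          module Tips {x d} (Rx : R x) (Rd : R d) (tx : t ~ x) (td : t ~ d) (x≢d : x ≢ d) (¬Wt : ¬ W G t)
            {P : Pred (Fin n) 0ℓ} (tip : ∀ {v p} → T v → v ≢ s → Leaf T v p → v ~ x ⊎ P v) where

            -- The walk is an ear of `R` from `x` to `b`. Closed by a path through `d`, it gives a
            -- cycle containing the neighbours `x`, `s` and `d` of `t`.
            no-return : ∀ {w v v′ b} → Walk v w v′ → Unique w → w ⊑ T → s ∈ w → v ~ x → v′ ~ b → R b → x ≢ b → ⊥
            no-return p un w⊑ s∈ vx vb Rb xb = ¬Wt
              (ear-wheel-at (ear-twoConn tc e) (walk⇒ear p un (λ m → proj₁ (w⊑ m)) (sym vx) vb Rx Rb xb) Rd ¬Rt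
                (λ m → proj₂ (w⊑ m) refl) (inj₂ refl) s∈ tx ts td (λ { refl → ¬Rs Rx }) x≢d)

            exit-and-branch : ∀ {b m} → s ~ b → R b → x ≢ b → s ~ m → T m →
              (∀ {v w} → Walk v w s → Unique w → w ⊑ T → v ≢ s → P v → ⊥) → ⊥
            exit-and-branch sb Rb xb sm Tm κ = from (branch T? forest Ts sm Tm)
              where
              from : Branch T s → ⊥
              from (mkBranch q un w⊑ vs l) =
                [ (λ vx → no-return q un w⊑ (walk-last q) vx sb Rb xb) , κ q un w⊑ vs ]′
                  (tip (w⊑ (walk-first q)) vs l)

            branch-and-branch : ∀ {m m′} → s ~ m → T m → s ~ m′ → T m′ → m ≢ m′ →
              (∀ {u v w pu pv} → Walk u w v → Unique w → w ⊑ T → s ∈ w → u ≢ s → v ≢ s → u ≢ v →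
               Leaf T u pu → Leaf T v pv → P u → P v → ⊥) → ⊥
            branch-and-branch sm Tm sm′ Tm′ mm κ = from (two-branches T? forest Ts sm Tm sm′ Tm′ mm)
              where
              toward : ∀ {u v w pu pv} → Walk u w v → Unique w → w ⊑ T → s ∈ w → u ≢ s → v ≢ s →
                       Leaf T u pu → Leaf T v pv → P u
              toward {v = v} q un w⊑ s∈ us vs lu lv =
                [ (λ ux → ⊥-elim (leave ux (exit x (w⊑ (walk-last q)) vs lv))) , (λ Pu → Pu) ]′
                  (tip (w⊑ (walk-first q)) us lu)
                where
                leave : _ ~ x → (∃ λ b → v ~ b × R b × b ≢ x) → ⊥
                leave ux (b , vb , Rb , bx) = no-return q un w⊑ s∈ ux vb Rb (λ eq → bx (≡-sym eq))
              from : TwoBranches T s → ⊥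
              from (mkBranches q un w⊑ s∈ us vs uv lu lv) = κ q un w⊑ s∈ us vs uv lu lv
                (toward q un w⊑ s∈ us vs lu lv)
                (toward (walk-reverse q) (reverse-unique un) (λ m → w⊑ (reverse⁻ m)) (reverse⁺ s∈) vs us lv lu)

        module _ {α E β} (e : Ear D α E β) where

          -- Both ends of a maximal path in the forest are leaves; if they were different from v they would be
          -- adjacent centres, closing a cycle.
          all-leaf-centres : (∀ {t p} → ¬ (D ⊕ E) t → Leaf (λ v → ¬ (D ⊕ E) v) t p → ¬ ¬ W G t) →
            ∀ {v} → ¬ (D ⊕ E) v → (∀ {p} → Leaf (λ v → ¬ (D ⊕ E) v) v p → W G v → ⊥) → ⊥
          all-leaf-centres centre {v} ¬Rv κ
            with maximal (λ v → ¬? (⊕-dec D? E v)) (max e) (stop {v}) singleton-unique (λ { (here refl) → ¬Rv })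
          ... | mk with Maximal.x mk ≟ v | Maximal.y mk ≟ v
          ...   | yes refl | _ = centre ¬Rv (Maximal.leaf-x mk) (κ (Maximal.leaf-x mk))
          ...   | no _ | yes refl = centre ¬Rv (Maximal.leaf-y mk) (κ (Maximal.leaf-y mk))
          ...   | no xv | no yv = centre (M.within (walk-first M.walk)) M.leaf-x λ Wx →
                    centre (M.within (walk-last M.walk)) M.leaf-y λ Wy →
                    max e (cycle⇒core M.walk (sym (centres-adjacent Wx Wy x≢y)) M.unique (M.⊒w (here refl))
                      (λ eq → xv (≡-sym eq)) (λ eq → yv (≡-sym eq)) M.within)
            where
            module M = Maximal mk
            x≢y : M.x ≢ M.y
            x≢y eq = xv (≡-sym (single-walk (subst (Walk M.x M.list) (≡-sym eq) M.walk) M.unique (M.⊒w (here refl))))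

        -- Shortest ears with at least two vertices

        module LongEars (no-twins : ∀ {a b} → ¬ D a → ¬ D b → ¬ Twins G a b) {k : ℕ} (2≤k : 2 ≤ k)
          (short : ∀ {α E β} → Ear D α E β → k ≤ length E) where

          -- With two different neighbours in `D`, the vertex `v` alone would be an ear.
          one-label : ∀ {v d d′} → ¬ D v → D d → D d′ → v ~ d → v ~ d′ → d ≡ d′
          one-label {v} {d} {d′} ¬Dv Dd Dd′ vd vd′ with d ≟ d′
          ... | yes e = e
          ... | no ne = ⊥-elim (<⇒≱ 2≤k (short {E = v ∷ []} (walk⇒ear stop singleton-unique (λ { (here refl) → ¬Dv })
                          (sym vd) vd′ Dd Dd′ ne)))

          -- The bound by `k` says that the ear is a shortest one. A chord, or an edge from `c` to
          -- `D` other than one of the ear, would give a shorter ear or contradict `one-label`.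
          ear-neighbours : ∀ {α β c u} as bs → Ear D α (as ++ c ∷ bs) β → length (as ++ c ∷ bs) ≤ k →
                           (D ⊕ (as ++ c ∷ bs)) u → c ~ u → u ≡ lst α as ⊎ u ≡ hd bs β
          ear-neighbours {α} {β} {c} {u} as bs e@(mkEar v un o s en d _) le (inj₁ Du) cu = in-D as bs e le
            where
            ¬Dc = o (∈-insert as)
            in-D : ∀ as bs → Ear D α (as ++ c ∷ bs) β → length (as ++ c ∷ bs) ≤ k → u ≡ lst α as ⊎ u ≡ hd bs β
            in-D [] bs e le = inj₁ (one-label ¬Dc Du s cu (sym (proj₁ (Ear.via e))))
            in-D as@(_ ∷ _) [] e le = inj₂ (one-label ¬Dc Du en cu (proj₂ (via-split as (Ear.via e))))
            in-D as@(_ ∷ _) bs@(_ ∷ _) e le with u ≟ α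
            ... | no uα with length-end as bs [] (≤-trans le (short (reroute-end as [] e Du (λ eq → uα (≡-sym eq)) cu fits-[])))
            ...   | ()
            in-D as@(_ ∷ _) bs@(_ ∷ _) e le | yes refl
              with length-start as [] (c ∷ bs) (≤-trans le (short (reroute-start as [] e Du d (sym cu) fits-[])))
            ...   | ()
          ear-neighbours as bs e le (inj₂ u∈) cu with ∈-mid⁻ as u∈
          ... | inj₂ (inj₁ refl) = ⊥-elim (~⇒≢ cu refl)
          ... | inj₁ m with ∈-∃++ m
          ...   | A , [] , refl = inj₁ (≡-sym (lst-snoc _ A))
          ...   | A , B@(_ ∷ _) , refl
            with subst (λ l → Ear D _ l _) (++-assoc A (_ ∷ B) _) e | subst (_≤ k) (cong length (++-assoc A (_ ∷ B) _)) le
          ...     | e′ | le′ with length-middle A B [] _ (≤-trans le′ (short (reroute-middle A B [] e′ (sym cu) fits-[])))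
          ...       | ()
          ear-neighbours as bs e le (inj₂ u∈) cu | inj₂ (inj₂ m) with ∈-∃++ m
          ...   | [] , B , refl = inj₂ refl
          ...   | A@(_ ∷ _) , B , refl with length-middle as A [] _ (≤-trans le (short (reroute-middle as A [] e cu fits-[])))
          ...     | ()

          -- The bounds in `third` come from the two ears that pass through `d`, `t` and `x` and
          -- keep one side of the ear: the single new vertex `t` replaces the other side, which
          -- therefore has at most one vertex.
          data Position (α : Fin n) (E : List (Fin n)) (β t : Fin n) : Set where
            paired : ∀ as c bs → E ≡ as ++ c ∷ bs → t ~ lst α as → t ~ hd bs β → Position α E β t
            third  : ∀ as x bs {d} → E ≡ as ++ x ∷ bs → length as ≤ 1 → length bs ≤ 1 →
                     t ~ x → D d → t ~ d → d ≢ α → d ≢ β → Position α E β t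

          private
            label-position : ∀ {α β t d} as x bs → Ear D α (as ++ x ∷ bs) β → length (as ++ x ∷ bs) ≤ k →
              ¬ D t → t ∉ as ++ x ∷ bs → D d → t ~ x → t ~ d → Position α (as ++ x ∷ bs) β t
            label-position {α} {β} {t} {d} as x bs e le ¬Dt t∉ Dd tx td with d ≟ α | d ≟ β
            ... | no dα | no dβ = third as x bs refl
              (length-start as (t ∷ []) _
                  (≤-trans le (short (reroute-start as (t ∷ []) e Dd dβ (sym td , tx) (fits-[ ¬Dt ] t∉)))))
              (length-end as bs (t ∷ [])
                  (≤-trans le (short (reroute-end as (t ∷ []) e Dd (λ eq → dα (≡-sym eq)) (sym tx , td) (fits-[ ¬Dt ] t∉)))))
              tx Dd td dα dβ
            ... | yes refl | _ = from-start as e le t∉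
              where
              from-start : ∀ as → Ear D α (as ++ x ∷ bs) β → length (as ++ x ∷ bs) ≤ k → t ∉ as ++ x ∷ bs →
                           Position α (as ++ x ∷ bs) β t
              from-start [] e le t∉ = ⊥-elim (triangle-free td tx (proj₁ (Ear.via e)))
              from-start (c ∷ []) e le t∉ = paired [] c (x ∷ bs) refl td tx
              from-start as@(_ ∷ _ ∷ _) e le t∉
                with length-start as (t ∷ []) _
                    (≤-trans le (short (reroute-start as (t ∷ []) e Dd (Ear.ends≢ e) (sym td , tx) (fits-[ ¬Dt ] t∉))))
              ... | s≤s ()
            ... | no _ | yes refl = from-end bs e le t∉
              where
              from-end : ∀ bs → Ear D α (as ++ x ∷ bs) β → length (as ++ x ∷ bs) ≤ k → t ∉ as ++ x ∷ bs →
                         Position α (as ++ x ∷ bs) β t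
              from-end [] e le t∉ = ⊥-elim (triangle-free td tx (sym (proj₂ (via-split as (Ear.via e)))))
              from-end (c ∷ []) e le t∉ = paired (as ++ x ∷ []) c [] (≡-sym (++-assoc as (x ∷ []) (c ∷ [])))
                (subst (t ~_) (≡-sym (lst-snoc α as)) tx) td
              from-end bs@(_ ∷ _ ∷ _) e le t∉
                with length-end as bs (t ∷ [])
                    (≤-trans le (short (reroute-end as (t ∷ []) e Dd (Ear.ends≢ e) (sym tx , td) (fits-[ ¬Dt ] t∉))))
              ... | s≤s ()

            -- The route from `x` over `t` to `x′` cannot shorten the ear, so at most one vertex
            -- lies between `x` and `x′`; if there is none, a triangle arises.
            ear-position : ∀ {α β t x x′} P Q R → Ear D α (P ++ x ∷ Q ++ x′ ∷ R) β → length (P ++ x ∷ Q ++ x′ ∷ R) ≤ k →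
              ¬ D t → t ∉ P ++ x ∷ Q ++ x′ ∷ R → t ~ x → t ~ x′ → Position α (P ++ x ∷ Q ++ x′ ∷ R) β t
            ear-position P [] R e le ¬Dt t∉ tx tx′ =
              ⊥-elim (triangle-free tx tx′ (proj₁ (proj₂ (via-split P (Ear.via e)))))
            ear-position {α} {t = t} P (c ∷ []) R e le ¬Dt t∉ tx tx′ =
              paired (P ++ _ ∷ []) c (_ ∷ R) (≡-sym (++-assoc P _ _)) (subst (t ~_) (≡-sym (lst-snoc α P)) tx) tx′
            ear-position {t = t} P Q@(_ ∷ _ ∷ _) R e le ¬Dt t∉ tx tx′
              with length-middle P Q (t ∷ []) _
                  (≤-trans le (short (reroute-middle P Q (t ∷ []) e (sym tx , tx′) (fits-[ ¬Dt ] t∉))))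
            ... | s≤s ()

          position : ∀ {α E β t g g′} → Ear D α E β → length E ≤ k → ¬ (D ⊕ E) t →
                     (D ⊕ E) g → (D ⊕ E) g′ → g ≢ g′ → t ~ g → t ~ g′ → Position α E β t
          position e le ¬t (inj₁ Dg) (inj₁ Dg′) ne tg tg′ =
            ⊥-elim (ne (one-label (λ Dt → ¬t (inj₁ Dt)) Dg Dg′ tg tg′))
          position e le ¬t (inj₁ Dg) (inj₂ m) ne tg tg′ with ∈-∃++ m
          ... | as , bs , refl = label-position as _ bs e le (λ Dt → ¬t (inj₁ Dt)) (λ q → ¬t (inj₂ q)) Dg tg′ tg
          position e le ¬t (inj₂ m) (inj₁ Dg′) ne tg tg′ with ∈-∃++ m
          ... | as , bs , refl = label-position as _ bs e le (λ Dt → ¬t (inj₁ Dt)) (λ q → ¬t (inj₂ q)) Dg′ tg tg′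
          position e le ¬t (inj₂ m) (inj₂ m′) ne tg tg′ with ordered m m′ ne
          ... | inj₁ (P , Q , R , refl) = ear-position P Q R e le (λ Dt → ¬t (inj₁ Dt)) (λ q → ¬t (inj₂ q)) tg tg′
          ... | inj₂ (P , Q , R , refl) = ear-position P Q R e le (λ Dt → ¬t (inj₁ Dt)) (λ q → ¬t (inj₂ q)) tg′ tg

          -- Exchanging a vertex of a shortest ear with an outer vertex

          module Swap {α β c t} as bs (e : Ear D α (as ++ c ∷ bs) β) (le : length (as ++ c ∷ bs) ≤ k)
            (¬Rt : ¬ (D ⊕ (as ++ c ∷ bs)) t) (ty : t ~ lst α as) (tz : t ~ hd bs β) where

            E = as ++ c ∷ bs
            E′ = as ++ t ∷ bs
            R = D ⊕ E
            R′ = D ⊕ E′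
            y = lst α as
            z = hd bs β

            ¬Dt : ¬ D t
            ¬Dt Dt = ¬Rt (inj₁ Dt)

            t∉E : t ∉ E
            t∉E m = ¬Rt (inj₂ m)

            c∈E : c ∈ E
            c∈E = ∈-insert as

            ¬Dc : ¬ D c
            ¬Dc = Ear.outside e c∈E

            t≢c : t ≢ c
            t≢c refl = t∉E c∈E

            e′ : Ear D α E′ β
            e′ = swap-vertex as bs e ty tz ¬Dt t∉E

            le′ : length E′ ≤ k
            le′ rewrite length-++ as {t ∷ bs} | length-++ as {c ∷ bs} = le

            cy : c ~ y
            cy = sym (via-last as (proj₁ (via-split as (Ear.via e))))

            cz : c ~ z
            cz = via-head bs (proj₂ (via-split as (Ear.via e)))

            t≁c : ¬ t ~ c
            t≁c tc = triangle-free tc ty cy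

            c-neighbours : ∀ {u} → R u → c ~ u → u ≡ y ⊎ u ≡ z
            c-neighbours = ear-neighbours as bs e le

            t-neighbours : ∀ {u} → R′ u → t ~ u → u ≡ y ⊎ u ≡ z
            t-neighbours = ear-neighbours as bs e′ le′

            R⇒R′ : ∀ {u} → R u → u ≢ c → R′ u
            R⇒R′ (inj₁ Du) uc = inj₁ Du
            R⇒R′ (inj₂ m) uc with ∈-mid⁻ as m
            ... | inj₁ p = inj₂ (∈-mid⁺ as (inj₁ p))
            ... | inj₂ (inj₁ p) = ⊥-elim (uc p)
            ... | inj₂ (inj₂ p) = inj₂ (∈-mid⁺ as (inj₂ p))

            R′⇒R : ∀ {u} → R′ u → u ≢ t → R u
            R′⇒R (inj₁ Du) ut = inj₁ Du
            R′⇒R (inj₂ m) ut with ∈-mid⁻ as m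
            ... | inj₁ p = inj₂ (∈-mid⁺ as (inj₁ p))
            ... | inj₂ (inj₁ p) = ⊥-elim (ut p)
            ... | inj₂ (inj₂ p) = inj₂ (∈-mid⁺ as (inj₂ p))

            Ry : R y
            Ry with lst∈ α as
            ... | inj₁ eq = inj₁ (subst D (≡-sym eq) (Ear.start∈ e))
            ... | inj₂ m = inj₂ (∈-mid⁺ as (inj₁ m))

            Rz : R z
            Rz with hd∈ bs β
            ... | inj₁ eq = inj₁ (subst D (≡-sym eq) (Ear.end∈ e))
            ... | inj₂ m = inj₂ (∈-mid⁺ as (inj₂ m))

            y≢c : y ≢ c
            y≢c eq = ~⇒≢ cy (≡-sym eq)

            z≢c : z ≢ c
            z≢c eq = ~⇒≢ cz (≡-sym eq)

            y≢z : y ≢ z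
            y≢z eq with lst∈ α as | hd∈ bs β
            ... | inj₁ p | inj₁ q = Ear.ends≢ e (trans (≡-sym p) (trans eq q))
            ... | inj₁ p | inj₂ q = Ear.outside e (∈-mid⁺ as (inj₂ q)) (subst D (trans (≡-sym p) eq) (Ear.start∈ e))
            ... | inj₂ p | inj₁ q = Ear.outside e (∈-mid⁺ as (inj₁ p)) (subst D (trans (≡-sym q) (≡-sym eq)) (Ear.end∈ e))
            ... | inj₂ p | inj₂ q = proj₂ (proj₂ (unique-++⁻ as (Ear.distinct e))) p (there (subst (_∈ bs) (≡-sym eq) q))

            ¬R′c : ¬ R′ c
            ¬R′c (inj₁ Dc) = ¬Dc Dc
            ¬R′c (inj₂ m) with unique-++⁻ as (Ear.distinct e) | ∈-mid⁻ as m
            ... | _ , _ , d | inj₁ p = d p (here refl)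
            ... | _ | inj₂ (inj₁ p) = t≢c (≡-sym p)
            ... | _ , u , _ | inj₂ (inj₂ p) = head∉tail u p

            T : Pred (Fin n) 0ℓ
            T v = ¬ R v × v ≢ t

            T? : Decidable T
            T? v = ¬? (⊕-dec D? E v) ×-dec ¬? (v ≟ t)

            T⇒¬R′ : ∀ {v} → T v → ¬ R′ v
            T⇒¬R′ (¬Rv , vt) R′v = ¬Rv (R′⇒R R′v vt)

            T∌c : ∀ {v} → T v → v ≢ c
            T∌c (¬Rv , _) refl = ¬Rv (inj₂ c∈E)

            forest : ¬ Core T
            forest core = max e (core-mono proj₁ core)

            classify : ∀ u → (R u × u ≢ c) ⊎ u ≡ c ⊎ u ≡ t ⊎ T u
            classify u with ⊕-dec D? E u | u ≟ c | u ≟ t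
            ... | _      | yes p | _     = inj₂ (inj₁ p)
            ... | yes r  | no p  | _     = inj₁ (r , p)
            ... | no _   | no _  | yes q = inj₂ (inj₂ (inj₁ q))
            ... | no r   | no _  | no q  = inj₂ (inj₂ (inj₂ (r , q)))

            -- Outside `D` and the exchanged ear `E′` lie the vertices of `T` and `c`; maximality
            -- makes them acyclic too.
            no-cycle-through-c : ∀ {x w y u v} → Walk x w y → Unique w → w ⊑ T → u ∈ w → v ∈ w → u ≢ v →
                                 c ~ u → c ~ v → ⊥
            no-cycle-through-c p un s u∈ v∈ uv cu cv = max e′
              (apex⇒core p un (λ m → T⇒¬R′ (s m)) ¬R′c (λ m → T∌c (s m) refl) u∈ v∈ uv cu cv)

            module WithLeaf {s} (Ts : T s) (ts : t ~ s) (leaf : Leaf (λ v → ¬ R v) t s) where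

              t~T : ∀ {v} → T v → t ~ v → v ≡ s
              t~T (¬Rv , _) = leaf ¬Rv

              -- A further neighbour of c would start paths in T leaving through two vertices of R,
              -- which makes c a centre of degree at least four.
              no-further-neighbour : c ~ s → ∀ {g} → c ~ g → T g → g ≢ s → ⊥
              no-further-neighbour cs {g} cg Tg gs = conclude (two-neighbours g c)
                where
                finish : ∀ {a L b} → Ear R′ a L b → L ⊑ T → g ∈ L → t ≢ a → t ≢ b → ⊥
                -- The roles of `c` and `t` are exchanged here: a path inside `R′` through `t`
                -- visits `y` and `z`, and the ear contributes `g` as the third neighbour of `c`.
                finish ear L⊑ g∈ ta tb = degree≥4⇒¬centre cy cz cs cg y≢z
                  (λ { refl → proj₁ Ts Ry }) (λ { refl → proj₁ Tg Ry }) (λ eq → proj₁ Ts (subst R eq Rz))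
                  (λ eq → proj₁ Tg (subst R eq Rz)) (λ eq → gs (≡-sym eq))
                  (ear-wheel-through (ear-twoConn tc e′) (inj₂ (∈-insert as)) t-neighbours ear ta tb ¬R′c
                    (λ m → T∌c (L⊑ m) refl) (R⇒R′ Ry y≢c) (R⇒R′ Rz z≢c) y≢z g∈ cy cz cg)

                finish-walk : ∀ {x w x′ a b} → Walk x w x′ → Unique w → w ⊑ T → g ∈ w → a ~ x → x′ ~ b →
                              R a × a ≢ c → R b × b ≢ c → a ≢ b → ⊥
                finish-walk p un w⊑ g∈ ax xb (Ra , ac) (Rb , bc) ab =
                  finish (walk⇒ear p un (λ m → T⇒¬R′ (w⊑ m)) ax xb (R⇒R′ Ra ac) (R⇒R′ Rb bc) ab) w⊑ g∈
                    (λ { refl → ¬Rt Ra }) (λ { refl → ¬Rt Rb })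

                exit : ∀ {x p} b → T x → x ≢ s → ¬ c ~ x → Leaf T x p → ∃ λ a → a ~ x × (R a × a ≢ c) × a ≢ b
                exit {x} {p} b Tx xs cx l with other-neighbour x p b
                ... | a , xa , ap , ab with classify a
                ...   | inj₁ r = a , sym xa , r , ab
                ...   | inj₂ (inj₁ refl) = ⊥-elim (cx (sym xa))
                ...   | inj₂ (inj₂ (inj₁ refl)) = ⊥-elim (xs (t~T Tx (sym xa)))
                ...   | inj₂ (inj₂ (inj₂ Ta)) = ⊥-elim (ap (l Ta xa))

                ≁c : ∀ {x w x′ v} → Walk x w x′ → Unique w → w ⊑ T → g ∈ w → v ∈ w → v ≢ g → ¬ c ~ v
                ≁c q un w⊑ g∈ v∈ vg cv = no-cycle-through-c q un w⊑ v∈ g∈ vg cv cg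

                one-exit : ∀ {b m} → g ~ b → R b × b ≢ c → g ~ m → T m → ⊥
                one-exit {b} gb rb gm Tm = from (branch T? forest Tg gm Tm)
                  where
                  from : Branch T g → ⊥
                  from (mkBranch q un w⊑ vg l) with ≁c q un w⊑ (walk-last q) (walk-first q) vg
                  ... | c≁ with exit b (w⊑ (walk-first q)) (λ { refl → c≁ cs }) c≁ l
                  ...   | a , ax , ra , ab = finish-walk q un w⊑ (walk-last q) ax gb ra rb ab

                no-exit : ∀ {m m′} → g ~ m → T m → g ~ m′ → T m′ → m ≢ m′ → ⊥
                no-exit gm Tm gm′ Tm′ mm = from (two-branches T? forest Tg gm Tm gm′ Tm′ mm)
                  where
                  from : TwoBranches T g → ⊥
                  from (mkBranches {u} q un w⊑ g∈ ug vg uv l l′)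
                    with ≁c q un w⊑ g∈ (walk-first q) ug | ≁c q un w⊑ g∈ (walk-last q) vg
                  ... | c≁u | c≁v with exit u (w⊑ (walk-first q)) (λ { refl → c≁u cs }) c≁u l
                  ...   | a , ax , ra , _ with exit a (w⊑ (walk-last q)) (λ { refl → c≁v cs }) c≁v l′
                  ...     | b , bx , rb , ba = finish-walk q un w⊑ g∈ ax (sym bx) ra rb (λ eq → ba (≡-sym eq))

                T-or-exit : ∀ {u} → g ~ u → u ≢ c → (R u × u ≢ c) ⊎ T u
                T-or-exit {u} gu uc with classify u
                ... | inj₁ r = inj₁ r
                ... | inj₂ (inj₁ p) = ⊥-elim (uc p)
                ... | inj₂ (inj₂ (inj₁ refl)) = ⊥-elim (gs (t~T Tg (sym gu)))
                ... | inj₂ (inj₂ (inj₂ Tu)) = inj₂ Tu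

                conclude : TwoNeighbours g c → ⊥
                conclude (u , u′ , gu , uc , gu′ , uc′ , uu) with T-or-exit gu uc | T-or-exit gu′ uc′
                ... | inj₁ r | inj₁ r′ = finish-walk stop singleton-unique (λ { (here refl) → Tg }) (here refl)
                                           (sym gu) gu′ r r′ uu
                ... | inj₁ r | inj₂ Tu′ = one-exit gu r gu′ Tu′
                ... | inj₂ Tu | inj₁ r′ = one-exit gu′ r′ gu Tu
                ... | inj₂ Tu | inj₂ Tu′ = no-exit gu Tu gu′ Tu′ uu

              common-neighbour⇒⊥ : ¬ c ~ s
              common-neighbour⇒⊥ cs = no-twins ¬Dt ¬Dc (twins t≢c t≁c y≢z (λ { refl → proj₁ Ts Ry })
                (λ eq → proj₁ Ts (subst R eq Rz))
                (λ { (here refl) → ty ; (there (here refl)) → tz ; (there (there (here refl))) → ts })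
                (λ { (here refl) → cy ; (there (here refl)) → cz ; (there (there (here refl))) → cs })
                (λ {v} → t-all {v}) (λ {v} → c-all {v}))
                where
                pack : ∀ {v} → v ≡ y ⊎ v ≡ z → v ∈ y ∷ z ∷ s ∷ []
                pack (inj₁ eq) = here eq
                pack (inj₂ eq) = there (here eq)
                t-all : ∀ {v} → t ~ v → v ∈ y ∷ z ∷ s ∷ []
                t-all {v} tv with classify v
                ... | inj₁ (Rv , vc) = pack (t-neighbours (R⇒R′ Rv vc) tv)
                ... | inj₂ (inj₁ refl) = ⊥-elim (t≁c tv)
                ... | inj₂ (inj₂ (inj₁ refl)) = ⊥-elim (~⇒≢ tv refl)
                ... | inj₂ (inj₂ (inj₂ Tv)) = there (there (here (t~T Tv tv)))
                c-all : ∀ {v} → c ~ v → v ∈ y ∷ z ∷ s ∷ []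
                c-all {v} cv with classify v
                ... | inj₁ (Rv , vc) = pack (c-neighbours Rv cv)
                ... | inj₂ (inj₁ refl) = ⊥-elim (~⇒≢ cv refl)
                ... | inj₂ (inj₂ (inj₁ refl)) = ⊥-elim (t≁c (sym cv))
                ... | inj₂ (inj₂ (inj₂ Tv)) with v ≟ s
                ...   | yes refl = there (there (here refl))
                ...   | no vs = ⊥-elim (no-further-neighbour cs cv Tv vs)

              module _ (cs : ¬ c ~ s) (¬Wt : ¬ W G t) where

                private
                  -- The closing path in `R` is led through `c` and so visits both `y` and `z`,
                  -- while `s` lies on the ear: `t` would be a centre. The ends must differ from `c`
                  -- for `c` to be interior to the closing path.
                  finish : ∀ {x w x′ a b} → Walk x w x′ → Unique w → w ⊑ T → s ∈ w → a ~ x → x′ ~ b →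
                           R a × a ≢ c → R b × b ≢ c → a ≢ b → ⊥
                  finish p un w⊑ s∈ ax xb (Ra , ac) (Rb , bc) ab = ¬Wt
                    (ear-wheel-through (ear-twoConn tc e) (inj₂ c∈E) c-neighbours
                      (walk⇒ear p un (λ m → proj₁ (w⊑ m)) ax xb Ra Rb ab)
                      (λ eq → ac (≡-sym eq)) (λ eq → bc (≡-sym eq)) ¬Rt (λ m → proj₂ (w⊑ m) refl)
                      Ry Rz y≢z s∈ ty tz ts)

                  neighbour : ∀ {x u} → T x → x ≢ s → x ~ u → (R u × u ≢ c) ⊎ u ≡ c ⊎ T u
                  neighbour {u = u} Tx xs xu with classify u
                  ... | inj₁ r = inj₁ r
                  ... | inj₂ (inj₁ eq) = inj₂ (inj₁ eq)
                  ... | inj₂ (inj₂ (inj₁ refl)) = ⊥-elim (xs (t~T Tx (sym xu)))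
                  ... | inj₂ (inj₂ (inj₂ Tu)) = inj₂ (inj₂ Tu)

                  exit : ∀ {x p} b → T x → x ≢ s → Leaf T x p → ∃ λ a → x ~ a × a ≢ b × ((R a × a ≢ c) ⊎ a ≡ c)
                  exit {x} {p} b Tx xs l with other-neighbour x p b
                  ... | a , xa , ap , ab with neighbour Tx xs xa
                  ...   | inj₁ r = a , xa , ab , inj₁ r
                  ...   | inj₂ (inj₁ eq) = a , xa , ab , inj₂ eq
                  ...   | inj₂ (inj₂ Ta) = ⊥-elim (ap (l Ta xa))

                  exit-≢c : ∀ {x p} → T x → x ≢ s → Leaf T x p → ∃ λ a → x ~ a × R a × a ≢ c
                  exit-≢c Tx xs l with exit c Tx xs l
                  ... | a , xa , ac , inj₁ r = a , xa , r
                  ... | a , xa , ac , inj₂ eq = ⊥-elim (ac eq)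

                  -- One tip leaves `T` at some vertex `a` other than `c`. The other tip has an exit
                  -- different from `a`, which by `finish` can only be `c`. By symmetry both tips
                  -- are adjacent to `c`, which closes a cycle.
                  no-exit : ∀ {m m′} → s ~ m → T m → s ~ m′ → T m′ → m ≢ m′ → ⊥
                  no-exit sm Tm sm′ Tm′ mm = from (two-branches T? forest Ts sm Tm sm′ Tm′ mm)
                    where
                    toward : ∀ {u v pu pv w} → Leaf T u pu → Leaf T v pv → u ≢ s → v ≢ s →
                             Walk u w v → Unique w → w ⊑ T → s ∈ w → c ~ v
                    toward lu lv us vs p un w⊑ s∈ with exit-≢c (w⊑ (walk-first p)) us lu
                    ... | a , ua , ra with exit a (w⊑ (walk-last p)) vs lv
                    ...   | b , vb , ba , inj₁ rb = ⊥-elim (finish p un w⊑ s∈ (sym ua) vb ra rb (λ eq → ba (≡-sym eq)))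
                    ...   | b , vb , ba , inj₂ refl = sym vb
                    from : TwoBranches T s → ⊥
                    from (mkBranches q un w⊑ s∈ us vs uv lu lv) =
                      no-cycle-through-c q un w⊑ (walk-first q) (walk-last q) uv
                        (toward lv lu vs us (walk-reverse q) (reverse-unique un) (λ v∈ → w⊑ (reverse⁻ v∈)) (reverse⁺ s∈))
                        (toward lu lv us vs q un w⊑ s∈)

                  -- By `finish` the tip `x` of the branch through `m` can leave `T` only at `b` and
                  -- `c`, and it has two exits, so it is adjacent to both. Since `s`, `m` and `b`
                  -- form no triangle, `m` is not this tip.
                  one-exit : ∀ {b m} → s ~ b → R b × b ≢ c → s ~ m → T m → ⊥
                  one-exit {b} {m} sb rb sm Tm
                    with extend T? forest (sym sm ◅ stop) (cons-unique (λ { (here refl) → ~⇒≢ sm refl }) singleton-unique)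
                                (λ { (here refl) → Tm ; (there (here refl)) → Ts })
                  ... | mkExtension f {x} q un w⊑ l = split f q un w⊑
                    where
                    Tx = w⊑ (walk-first q)
                    x≢s : x ≢ s
                    x≢s refl = ~⇒≢ sm (≡-sym (single-walk q un (∈-++⁺ʳ f (here refl))))
                    m≢s : m ≢ s
                    m≢s eq = ~⇒≢ sm (≡-sym eq)
                    cx : c ~ x
                    cx with exit b Tx x≢s l
                    ... | a , xa , ab , inj₁ ra = ⊥-elim (finish q un w⊑ (walk-last q) (sym xa) sb ra rb ab)
                    ... | a , xa , ab , inj₂ refl = sym xa
                    xb : x ~ b
                    xb with exit-≢c Tx x≢s l
                    ... | a , xa , ra with a ≟ b
                    ...   | yes refl = xa
                    ...   | no ab = ⊥-elim (finish q un w⊑ (walk-last q) (sym xa) sb ra rb ab)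
                    m≁b : ¬ m ~ b
                    m≁b mb = triangle-free sm sb mb

                    -- A third neighbour of m gives another path through s leaving T outside c.
                    fork : ∀ w → Walk m w x → Unique w → w ⊑ T → s ∉ w → m ≢ x → ⊥
                    fork (_ ∷ []) stop un w⊑ s∉ mx = mx refl
                    fork (_ ∷ r ∷ w) p un w⊑ s∉ mx with walk-head p
                    ... | refl with other-neighbour m s r
                    ...   | z , mz , zs , zr with neighbour Tm m≢s mz
                    ...     | inj₂ (inj₁ refl) = no-cycle-through-c p un w⊑ (walk-first p) (walk-last p) mx (sym mz) cx
                    ...     | inj₁ rz with z ≟ b
                    ...       | yes refl = m≁b mz
                    ...       | no zb = finish (sym sm ◅ stop) (cons-unique (λ { (here refl) → m≢s refl }) singleton-unique)
                                          (λ { (here refl) → Tm ; (there (here refl)) → Ts }) (there (here refl))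
                                          (sym mz) sb rz rb zb
                    fork (_ ∷ r ∷ w) p un w⊑ s∉ mx | refl | z , mz , zs , zr | inj₂ (inj₂ Tz)
                      with z ∈? (m ∷ r ∷ w)
                    ... | yes (here eq) = ~⇒≢ mz (≡-sym eq)
                    ... | yes (there (here eq)) = zr eq
                    ... | yes (there (there z∈)) = max e (core-mono proj₁ (chord⇒core p un w⊑ z∈ mz))
                    ... | no z∉ with extend T? forest (sym mz ◅ p) (cons-unique z∉ un) (λ { (here refl) → Tz ; (there v∈) → w⊑ v∈ })
                    ...   | mkExtension g {x″} q′ un′ w⊑′ l′ = decide (s ∈? (g ++ z ∷ []))
                      where
                      prefix : Walk x″ (g ++ z ∷ []) z
                      prefix = proj₁ (walk-split g q′)
                      ug = unique-++⁻ g un′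
                      prefix-unique : Unique (g ++ z ∷ [])
                      prefix-unique = ++-unique (proj₁ ug) singleton-unique
                        λ { v∈ (here refl) → proj₂ (proj₂ ug) v∈ (here refl) }
                      m∉prefix : m ∉ g ++ z ∷ []
                      m∉prefix v∈ with ∈-snoc⁻ g v∈
                      ... | inj₁ v∈g = proj₂ (proj₂ ug) v∈g (there (here refl))
                      ... | inj₂ refl = ~⇒≢ mz refl
                      prefix⊑ : (g ++ z ∷ []) ⊑ T
                      prefix⊑ v∈ with ∈-snoc⁻ g v∈
                      ... | inj₁ v∈g = w⊑′ (∈-++⁺ˡ v∈g)
                      ... | inj₂ refl = Tz
                      x″≢x : x″ ≢ x
                      x″≢x refl = ~⇒≢ mz (trans (single-walk q′ un′ (∈-++⁺ʳ g (there (here refl))))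
                                           (≡-sym (single-walk q′ un′ (∈-++⁺ʳ g (here refl)))))
                      -- If the new branch meets `s`, it joins the neighbours `z` and `s` of `m`,
                      -- and a cycle arises. Otherwise its tip has an exit other than `b`: if this
                      -- is `c`, the two tips close a cycle through `c`; if not, the path from the
                      -- tip over `z` and `m` to `s` leaves `T` at two suitable vertices.
                      decide : Dec (s ∈ g ++ z ∷ []) → ⊥
                      decide (yes s∈) = max e (core-mono proj₁ (apex⇒core prefix prefix-unique prefix⊑ Tm m∉prefix s∈
                        (walk-last prefix) (λ eq → zs (≡-sym eq)) (sym sm) mz))
                      decide (no s∉g) with exit b (w⊑′ (walk-first q′)) (λ { refl → s∉g (walk-first prefix) }) l′
                      ... | a , xa , ab , inj₂ refl =
                            no-cycle-through-c q′ un′ w⊑′ (walk-first q′) (walk-last q′) x″≢x (sym xa) cx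
                      ... | a , xa , ab , inj₁ ra = finish (walk-++ prefix (sym mz) (sym sm ◅ stop))
                            (++-unique prefix-unique (cons-unique (λ { (here refl) → m≢s refl }) singleton-unique)
                              λ { v∈ (here refl) → m∉prefix v∈ ; v∈ (there (here refl)) → s∉g v∈ })
                            (λ v∈ → [ prefix⊑ , (λ { (here refl) → Tm ; (there (here refl)) → Ts }) ] (∈-++⁻ (g ++ z ∷ []) v∈))
                            (∈-++⁺ʳ (g ++ z ∷ []) (there (here refl))) (sym xa) sb ra rb ab

                    split : ∀ f → Walk x (f ++ m ∷ s ∷ []) s → Unique (f ++ m ∷ s ∷ []) → (f ++ m ∷ s ∷ []) ⊑ T → ⊥
                    split [] q un w⊑ with walk-head q
                    ... | refl = m≁b xb
                    split f@(_ ∷ _) q un w⊑ = fork (reverse (f ++ m ∷ [])) (walk-reverse (proj₁ (walk-split f q)))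
                      (reverse-unique (++-unique (proj₁ uf) singleton-unique
                        λ { v∈ (here refl) → proj₂ (proj₂ uf) v∈ (here refl) }))
                      (λ v∈ → [ (λ v∈f → w⊑ (∈-++⁺ˡ v∈f)) , (λ { refl → Tm }) ] (∈-snoc⁻ f (reverse⁻ v∈)))
                      (λ v∈ → [ (λ v∈f → proj₂ (proj₂ uf) v∈f (there (here refl))) , (λ eq → m≢s (≡-sym eq)) ]
                        (∈-snoc⁻ f (reverse⁻ v∈)))
                      λ { refl → proj₂ (proj₂ uf) (here (walk-head q)) (here refl) }
                      where uf = unique-++⁻ f un

                distant-leaf⇒⊥ : ⊥
                distant-leaf⇒⊥ = from (two-neighbours s t)
                  where
                  side : ∀ {v} → s ~ v → v ≢ t → (R v × v ≢ c) ⊎ T v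
                  side {v} sv vt with classify v
                  ... | inj₁ r = inj₁ r
                  ... | inj₂ (inj₁ refl) = ⊥-elim (cs (sym sv))
                  ... | inj₂ (inj₂ (inj₁ eq)) = ⊥-elim (vt eq)
                  ... | inj₂ (inj₂ (inj₂ Tv)) = inj₂ Tv
                  from : TwoNeighbours s t → ⊥
                  from (u , u′ , su , ut , su′ , u′t , uu) with side su ut | side su′ u′t
                  ... | inj₁ r | inj₁ r′ =
                      finish stop singleton-unique (λ { (here refl) → Ts }) (here refl) (sym su) su′ r r′ uu
                  ... | inj₁ r | inj₂ Tu′ = one-exit su r su′ Tu′
                  ... | inj₂ Tu | inj₁ r′ = one-exit su′ r′ su Tu
                  ... | inj₂ Tu | inj₂ Tu′ = no-exit su Tu su′ Tu′ uu

            -- Since `t` lies on the exchanged shortest ear, its neighbours there and in `D` are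
            -- only `y` and `z`, so a third neighbour `s` lies in the forest. Adjacency of `c` and
            -- `s` separates the case of twins from that of a wheel.
            paired-leaf⇒⊥ : ∀ {p} → Leaf (λ v → ¬ R v) t p → ¬ ¬ W G t
            paired-leaf⇒⊥ {p} leaf ¬Wt with other-neighbour t y z
            ... | s , ts , sy , sz with classify s
            ...   | inj₁ (Rs , sc) = [ sy , sz ] (t-neighbours (R⇒R′ Rs sc) ts)
            ...   | inj₂ (inj₁ refl) = t≁c ts
            ...   | inj₂ (inj₂ (inj₁ refl)) = ~⇒≢ ts refl
            ...   | inj₂ (inj₂ (inj₂ Ts)) with leaf (proj₁ Ts) ts | adj? c s
            ...     | refl | yes cs = WithLeaf.common-neighbour⇒⊥ Ts ts leaf cs
            ...     | refl | no cs = WithLeaf.distant-leaf⇒⊥ Ts ts leaf cs ¬Wt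

          -- Shortest ears with two vertices and a leaf attached elsewhere to `D`

          module TwoEar {α β x₁ x₂} (e : Ear D α (x₁ ∷ x₂ ∷ []) β) {t s d} (¬Rt : ¬ (D ⊕ (x₁ ∷ x₂ ∷ [])) t)
            (¬Rs : ¬ (D ⊕ (x₁ ∷ x₂ ∷ [])) s) (ts : t ~ s) (leaf : Leaf (λ v → ¬ (D ⊕ (x₁ ∷ x₂ ∷ [])) v) t s)
            (tx₁ : t ~ x₁) (Dd : D d) (td : t ~ d) (d≢α : d ≢ α) (d≢β : d ≢ β) (¬Wt : ¬ W G t) where

            open AtLeaf e ¬Rt ¬Rs ts leaf

            αx₁ = proj₁ (Ear.via e)
            x₁x₂ = proj₁ (proj₂ (Ear.via e))
            x₂β = proj₂ (proj₂ (Ear.via e))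
            Dα = Ear.start∈ e
            Dβ = Ear.end∈ e

            ¬Dx₁ : ¬ D x₁
            ¬Dx₁ = Ear.outside e (here refl)

            ¬Dx₂ : ¬ D x₂
            ¬Dx₂ = Ear.outside e (there (here refl))

            ¬Dt : ¬ D t
            ¬Dt Dt = ¬Rt (inj₁ Dt)

            x₁≢d : x₁ ≢ d
            x₁≢d refl = ¬Dx₁ Dd

            x₁≢s : x₁ ≢ s
            x₁≢s refl = ¬Rs (inj₂ (here refl))

            x₂≢t : x₂ ≢ t
            x₂≢t refl = ¬Rt (inj₂ (there (here refl)))

            s≁x₁ : ¬ s ~ x₁
            s≁x₁ sx = triangle-free ts tx₁ sx

            -- Of two different exits, at most one lies in `D` by `one-label`.
            tip : ∀ {v p} → T v → v ≢ s → Leaf T v p → v ~ x₁ ⊎ v ~ x₂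
            tip {v} Tv vs l = from (two-exits Tv vs l)
              where
              from : (∃₂ λ a b → v ~ a × v ~ b × R a × R b × a ≢ b) → v ~ x₁ ⊎ v ~ x₂
              from (_ , _ , va , vb , inj₁ Da , inj₁ Db , ab) =
                ⊥-elim (ab (one-label (λ Dv → proj₁ Tv (inj₁ Dv)) Da Db va vb))
              from (_ , _ , va , vb , inj₂ (here refl) , _) = inj₁ va
              from (_ , _ , va , vb , inj₂ (there (here refl)) , _) = inj₂ va
              from (_ , _ , va , vb , inj₁ _ , inj₂ (here refl) , _) = inj₁ vb
              from (_ , _ , va , vb , inj₁ _ , inj₂ (there (here refl)) , _) = inj₂ vb

            open Tips (inj₂ (here refl)) (inj₁ Dd) tx₁ td x₁≢d ¬Wt tip

            -- A second ear of the same length, with `t` in place of `x₂`. What lies outside it is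
            -- `T` with `x₂`, so `x₂` closes no cycle with a path in `T`.
            e₁ : Ear D α (x₁ ∷ t ∷ []) d
            e₁ = mkEar (αx₁ , sym tx₁ , td) (cons-unique (λ { (here refl) → ~⇒≢ tx₁ refl }) singleton-unique)
                   (λ { (here refl) → ¬Dx₁ ; (there (here refl)) → ¬Dt }) Dα Dd (λ eq → d≢α (≡-sym eq)) λ ()

            T⇒¬R₁ : ∀ {v} → T v → ¬ (D ⊕ (x₁ ∷ t ∷ [])) v
            T⇒¬R₁ (¬Rv , vt) (inj₁ Dv) = ¬Rv (inj₁ Dv)
            T⇒¬R₁ (¬Rv , vt) (inj₂ (here eq)) = ¬Rv (inj₂ (here eq))
            T⇒¬R₁ (¬Rv , vt) (inj₂ (there (here eq))) = vt eq

            ¬R₁x₂ : ¬ (D ⊕ (x₁ ∷ t ∷ [])) x₂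
            ¬R₁x₂ (inj₁ Dx) = ¬Dx₂ Dx
            ¬R₁x₂ (inj₂ (here eq)) = ~⇒≢ x₁x₂ (≡-sym eq)
            ¬R₁x₂ (inj₂ (there (here eq))) = x₂≢t eq

            no-cycle-through-x₂ : ∀ {v w v′ a b} → Walk v w v′ → Unique w → w ⊑ T → a ∈ w → b ∈ w → a ≢ b →
                                  a ~ x₂ → b ~ x₂ → ⊥
            no-cycle-through-x₂ p un w⊑ a∈ b∈ ab ax bx = max e₁
              (apex⇒core p un (λ m → T⇒¬R₁ (w⊑ m)) ¬R₁x₂ (λ m → proj₁ (w⊑ m) (inj₂ (there (here refl))))
                  a∈ b∈ ab (sym ax) (sym bx))

            x₂-and-branch : ∀ {m} → s ~ x₂ → s ~ m → T m → ⊥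
            x₂-and-branch sx sm Tm = exit-and-branch sx (inj₂ (there (here refl))) (~⇒≢ x₁x₂) sm Tm
              λ q un w⊑ vs vx₂ → no-cycle-through-x₂ q un w⊑ (walk-first q) (walk-last q) vs vx₂ sx

            two-T-neighbours : ∀ {m m′} → s ~ m → T m → s ~ m′ → T m′ → m ≢ m′ → ⊥
            two-T-neighbours sm Tm sm′ Tm′ mm = branch-and-branch sm Tm sm′ Tm′ mm
              λ q un w⊑ _ _ _ uv _ _ ux vx → no-cycle-through-x₂ q un w⊑ (walk-first q) (walk-last q) uv ux vx

            data Side (u : Fin n) : Set where
              label : D u → Side u
              is-x₂ : u ≡ x₂ → Side u
              in-T  : T u → Side u

            side : ∀ {u} → s ~ u → u ≢ t → Side u
            side {u} su ut with classify u
            ... | inj₁ (inj₁ Du) = label Du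
            ... | inj₁ (inj₂ (here refl)) = ⊥-elim (s≁x₁ su)
            ... | inj₁ (inj₂ (there (here refl))) = is-x₂ refl
            ... | inj₂ (inj₁ eq) = ⊥-elim (ut eq)
            ... | inj₂ (inj₂ Tu) = in-T Tu

            no-two : ∀ {u u′} → s ~ u → s ~ u′ → u ≢ u′ → ¬ D u → ¬ D u′ → Side u → Side u′ → ⊥
            no-two su su′ uu ¬Du ¬Du′ (label Du) _ = ¬Du Du
            no-two su su′ uu ¬Du ¬Du′ _ (label Du′) = ¬Du′ Du′
            no-two su su′ uu ¬Du ¬Du′ (is-x₂ refl) (is-x₂ refl) = uu refl
            no-two su su′ uu ¬Du ¬Du′ (is-x₂ refl) (in-T Tu′) = x₂-and-branch su su′ Tu′
            no-two su su′ uu ¬Du ¬Du′ (in-T Tu) (is-x₂ refl) = x₂-and-branch su′ su Tu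
            no-two su su′ uu ¬Du ¬Du′ (in-T Tu) (in-T Tu′) = two-T-neighbours su Tu su′ Tu′ uu

            -- If `f` differs from `α`, the path `x₁`, `x₂`, `v`, ..., `s` is an ear of `D` from `α`
            -- to `f`; it contains the neighbours `x₁` and `s` of `t`, and closing it through `d`
            -- makes `t` a centre. If `f` is `α`, the path `x₂`, `v`, ..., `s`, `t` is an ear from
            -- `β` to `d`; closing it through `α` makes `x₁` a centre, so `s`, not being adjacent to
            -- `x₁`, is none.
            labelled : ∀ {v w f} → Walk v w s → Unique w → w ⊑ T → v ~ x₂ → s ~ f → D f → ⊥
            labelled {v} {w} {f} p un w⊑ vx₂ sf Df with f ≟ α
            ... | no fα = ¬Wt (ear-wheel-at tc
                    (walk⇒ear (x₁x₂ ◅ sym vx₂ ◅ p)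
                      (cons-unique (λ { (here refl) → ~⇒≢ x₁x₂ refl ; (there m) → proj₁ (w⊑ m) (inj₂ (here refl)) })
                        (cons-unique (λ m → proj₁ (w⊑ m) (inj₂ (there (here refl)))) un))
                      (λ { (here refl) → ¬Dx₁ ; (there (here refl)) → ¬Dx₂ ; (there (there m)) → λ Dv → proj₁ (w⊑ m) (inj₁ Dv) })
                      αx₁ sf Dα Df (λ eq → fα (≡-sym eq)))
                    Dd ¬Dt
                    (λ { (here refl) → ~⇒≢ tx₁ refl ; (there (here refl)) → x₂≢t refl ; (there (there m)) → proj₂ (w⊑ m) refl })
                    (inj₁ (here refl)) (there (there (walk-last p))) tx₁ ts td x₁≢s x₁≢d)
            ... | yes refl = conclude (other-neighbour s t f)
              where
              Wx₁ : W G x₁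
              Wx₁ = ear-wheel-at tc
                (walk⇒ear (walk-++ (sym vx₂ ◅ p) (sym ts) stop)
                  (++-unique (cons-unique (λ m → proj₁ (w⊑ m) (inj₂ (there (here refl)))) un) singleton-unique
                    λ { (here refl) (here refl) → x₂≢t refl ; (there m) (here refl) → proj₂ (w⊑ m) refl })
                  (λ m → [ (λ { (here refl) → ¬Dx₂ ; (there q) → λ Dv → proj₁ (w⊑ q) (inj₁ Dv) }) , (λ { refl → ¬Dt }) ]
                           (∈-snoc⁻ (x₂ ∷ w) m))
                  (sym x₂β) td Dβ Dd (λ eq → d≢β (≡-sym eq)))
                Dα ¬Dx₁
                (λ m → [ (λ { (here eq) → ~⇒≢ x₁x₂ eq ; (there q) → proj₁ (w⊑ q) (inj₂ (here refl)) })
                       , (λ eq → ~⇒≢ tx₁ (≡-sym eq)) ] (∈-snoc⁻ (x₂ ∷ w) m))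
                (inj₁ (here refl)) (there (∈-++⁺ʳ w (here refl))) x₁x₂ (sym tx₁) (sym αx₁) x₂≢t
                (λ { refl → ¬Dx₂ Dα })
              ¬Ws : ¬ W G s
              ¬Ws Ws = s≁x₁ (sym (centres-adjacent Wx₁ Ws x₁≢s))
              conclude : (∃ λ p → s ~ p × p ≢ t × p ≢ f) → ⊥
              -- On the ear `e₁` the neighbours of `x₁` are `α` and `t`, and both are adjacent to
              -- `s`: here `s` is the leaf and `x₁` the vertex exchanged with it.
              conclude (p , sp , pt , pf) = Swap.paired-leaf⇒⊥ [] (t ∷ []) e₁ 2≤k (T⇒¬R₁ Ts) sf (sym ts) leaf-s ¬Ws
                where
                ¬Ds : ¬ D s
                ¬Ds Ds = ¬Rs (inj₁ Ds)
                leaf-s : Leaf (λ v → ¬ (D ⊕ (x₁ ∷ t ∷ [])) v) s p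
                leaf-s {u} ¬R₁u su with u ≟ p
                ... | yes eq = eq
                ... | no up = ⊥-elim (no-two su sp up (λ Du → ¬R₁u (inj₁ Du)) (λ Dp → pf (one-label ¬Ds Dp Df sp sf))
                                (side su (λ eq → ¬R₁u (inj₂ (there (here eq))))) (side sp pt))

            leaf⇒⊥ : ⊥
            leaf⇒⊥ = from (two-neighbours s t)
              where
              one : ∀ {f v} → D f → s ~ f → s ~ v → Side v → v ≢ f → ⊥
              one Df sf sv (label Dv) vf = vf (one-label (λ Ds → ¬Rs (inj₁ Ds)) Dv Df sv sf)
              one Df sf sv (is-x₂ refl) vf = labelled stop singleton-unique (λ { (here refl) → Ts }) sv sf Df
              one Df sf sv (in-T Tv) vf = exit-and-branch sf (inj₁ Df) (λ { refl → ¬Dx₁ Df }) sv Tv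
                λ q un w⊑ _ vx₂ → labelled q un w⊑ vx₂ sf Df
              cases : ∀ {u u′} → s ~ u → s ~ u′ → u ≢ u′ → Side u → Side u′ → ⊥
              cases su su′ uu (label Du) σ = one Du su su′ σ (λ eq → uu (≡-sym eq))
              cases su su′ uu σ (label Du′) = one Du′ su′ su σ uu
              cases su su′ uu (is-x₂ refl) (is-x₂ refl) = uu refl
              cases su su′ uu (is-x₂ refl) (in-T Tu′) = x₂-and-branch su su′ Tu′
              cases su su′ uu (in-T Tu) (is-x₂ refl) = x₂-and-branch su′ su Tu
              cases su su′ uu (in-T Tu) (in-T Tu′) = two-T-neighbours su Tu su′ Tu′ uu
              from : TwoNeighbours s t → ⊥
              from (u , u′ , su , ut , su′ , u′t , uu) = cases su su′ uu (side su ut) (side su′ u′t)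

          -- If `d` and `d′` coincide there is a triangle, and otherwise an ear with two vertices.
          labelled-neighbours : 3 ≤ k → ∀ {u v d d′} → u ~ v → ¬ D u → ¬ D v → D d → D d′ → u ~ d → v ~ d′ → ⊥
          labelled-neighbours 3≤k {u} {v} {d} {d′} uv ¬Du ¬Dv Dd Dd′ ud vd′ with d ≟ d′
          ... | yes refl = triangle-free uv ud vd′
          ... | no ne = <⇒≱ 3≤k (short (walk⇒ear (uv ◅ stop)
                  (cons-unique (λ { (here refl) → ~⇒≢ uv refl }) singleton-unique)
                  (λ { (here refl) → ¬Du ; (there (here refl)) → ¬Dv }) (sym ud) vd′ Dd Dd′ ne))

          -- Shortest ears with three vertices and a leaf at the middle one

          module ThreeEar (3≤k : 3 ≤ k) {α β a x b} (e : Ear D α (a ∷ x ∷ b ∷ []) β) {t s d}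
            (¬Rt : ¬ (D ⊕ (a ∷ x ∷ b ∷ [])) t) (¬Rs : ¬ (D ⊕ (a ∷ x ∷ b ∷ [])) s) (ts : t ~ s)
            (leaf : Leaf (λ v → ¬ (D ⊕ (a ∷ x ∷ b ∷ [])) v) t s)
            (tx : t ~ x) (Dd : D d) (td : t ~ d) (¬Wt : ¬ W G t) where

            open AtLeaf e ¬Rt ¬Rs ts leaf

            αa = proj₁ (Ear.via e)
            ax = proj₁ (proj₂ (Ear.via e))
            xb = proj₁ (proj₂ (proj₂ (Ear.via e)))
            bβ = proj₂ (proj₂ (proj₂ (Ear.via e)))
            Dα = Ear.start∈ e
            Dβ = Ear.end∈ e

            a∈ : a ∈ a ∷ x ∷ b ∷ []
            a∈ = here refl

            x∈ : x ∈ a ∷ x ∷ b ∷ []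
            x∈ = there (here refl)

            b∈ : b ∈ a ∷ x ∷ b ∷ []
            b∈ = there (there (here refl))

            a≢b : a ≢ b
            a≢b refl = head∉tail (Ear.distinct e) (there (here refl))

            ¬D-ear : ∀ {v} → v ∈ a ∷ x ∷ b ∷ [] → ¬ D v
            ¬D-ear = Ear.outside e

            ¬Dt : ¬ D t
            ¬Dt Dt = ¬Rt (inj₁ Dt)

            T⇒¬D : ∀ {v} → T v → ¬ D v
            T⇒¬D Tv Dv = proj₁ Tv (inj₁ Dv)

            s≁x : ¬ s ~ x
            s≁x sx = triangle-free ts tx sx

            -- The vertices `a` and `b` have neighbours in `D`, so by `labelled-neighbours` an exit
            -- to `D` occurs together with neither of them.
            tip : ∀ {v p} → T v → v ≢ s → Leaf T v p → v ~ x ⊎ (v ~ a × v ~ b)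
            tip {v} Tv vs l = from (two-exits Tv vs l)
              where
              labelled-end : ∀ {g h} → D g → h ∈ a ∷ x ∷ b ∷ [] → v ~ g → v ~ h → v ~ x ⊎ (v ~ a × v ~ b)
              labelled-end Dg (here refl) vg vh =
                ⊥-elim (labelled-neighbours 3≤k vh (T⇒¬D Tv) (¬D-ear a∈) Dg Dα vg (sym αa))
              labelled-end Dg (there (here refl)) vg vh = inj₁ vh
              labelled-end Dg (there (there (here refl))) vg vh =
                ⊥-elim (labelled-neighbours 3≤k vh (T⇒¬D Tv) (¬D-ear b∈) Dg Dβ vg bβ)
              cases : ∀ {g h} → R g → R h → v ~ g → v ~ h → g ≢ h → v ~ x ⊎ (v ~ a × v ~ b)
              cases (inj₁ Dg) (inj₁ Dh) vg vh gh = ⊥-elim (gh (one-label (T⇒¬D Tv) Dg Dh vg vh))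
              cases (inj₁ Dg) (inj₂ h∈) vg vh gh = labelled-end Dg h∈ vg vh
              cases (inj₂ g∈) (inj₁ Dh) vg vh gh = labelled-end Dh g∈ vh vg
              cases (inj₂ (there (here refl))) (inj₂ _) vg vh gh = inj₁ vg
              cases (inj₂ _) (inj₂ (there (here refl))) vg vh gh = inj₁ vh
              cases (inj₂ (here refl)) (inj₂ (here refl)) vg vh gh = ⊥-elim (gh refl)
              cases (inj₂ (here refl)) (inj₂ (there (there (here refl)))) vg vh gh = inj₂ (vg , vh)
              cases (inj₂ (there (there (here refl)))) (inj₂ (here refl)) vg vh gh = inj₂ (vh , vg)
              cases (inj₂ (there (there (here refl)))) (inj₂ (there (there (here refl)))) vg vh gh = ⊥-elim (gh refl)
              from : (∃₂ λ g h → v ~ g × v ~ h × R g × R h × g ≢ h) → v ~ x ⊎ (v ~ a × v ~ b)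
              from (_ , _ , vg , vh , Rg , Rh , gh) = cases Rg Rh vg vh gh

            x≢d : x ≢ d
            x≢d refl = ¬D-ear x∈ Dd

            open Tips (inj₂ x∈) (inj₁ Dd) tx td x≢d ¬Wt tip

            -- Here `g` and `h` are `a` and `b` in some order. The cycle `x`, `h`, `v`, ..., `s`,
            -- `t` contains the neighbours `x`, `v` and `s` of `g`; the attachment `γ` of `g` in `D`
            -- is a fourth neighbour, too many for a centre.
            big-centre : ∀ {g h γ w v} → g ∈ a ∷ x ∷ b ∷ [] → h ∈ a ∷ x ∷ b ∷ [] → g ≢ h → g ≢ x → h ≢ x →
              g ~ x → h ~ x → D γ → g ~ γ → Walk v w s → Unique w → w ⊑ T → v ≢ s → v ~ g → v ~ h → s ~ g → ⊥
            big-centre {g} {h} {γ} {w} {v} g∈ h∈ gh gx hx gx~ hx~ Dγ gγ p un w⊑ vs vg vh sg =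
              degree≥4⇒¬centre gx~ (sym sg) (sym vg) gγ (λ { refl → ¬Rs (inj₂ x∈) })
                (λ { refl → proj₁ (w⊑ (walk-first p)) (inj₂ x∈) }) (λ { refl → ¬D-ear x∈ Dγ })
                (λ eq → vs (≡-sym eq)) (λ { refl → ¬Rs (inj₁ Dγ) }) (λ { refl → T⇒¬D (w⊑ (walk-first p)) Dγ })
                (wheel (sym hx~ ◅ walk-++ (sym vh ◅ p) (sym ts) stop) tx
                  (cons-unique (λ m → [ (λ { (here eq) → hx (≡-sym eq) ; (there q) → proj₁ (w⊑ q) (inj₂ x∈) })
                                      , (λ { refl → ¬Rt (inj₂ x∈) }) ] (∈-snoc⁻ (h ∷ w) m))
                    (++-unique (cons-unique (λ m → proj₁ (w⊑ m) (inj₂ h∈)) un) singleton-unique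
                      λ { (here refl) (here refl) → ¬Rt (inj₂ h∈) ; (there m) (here refl) → proj₂ (w⊑ m) refl }))
                  (λ { (here eq) → gx eq
                     ; (there m) → [ (λ { (here eq) → gh eq ; (there q) → proj₁ (w⊑ q) (inj₂ g∈) })
                                   , (λ { refl → ¬Rt (inj₂ g∈) }) ] (∈-snoc⁻ (h ∷ w) m) })
                  (here refl) (there (there (∈-++⁺ˡ (walk-last p)))) (there (there (∈-++⁺ˡ (walk-first p))))
                  gx~ (sym sg) (sym vg) (λ { refl → ¬Rs (inj₂ x∈) })
                  (λ { refl → proj₁ (w⊑ (walk-first p)) (inj₂ x∈) }) (λ eq → vs (≡-sym eq)))

            a-and-branch : ∀ {m} → s ~ a → s ~ m → T m → ⊥
            a-and-branch sa sm Tm = exit-and-branch sa (inj₂ a∈) (λ eq → ~⇒≢ ax (≡-sym eq)) sm Tm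
              λ q un w⊑ vs (va , vb) → big-centre a∈ b∈ a≢b (~⇒≢ ax) (λ eq → ~⇒≢ xb (≡-sym eq))
                ax (sym xb) Dα (sym αa) q un w⊑ vs va vb sa

            b-and-branch : ∀ {m} → s ~ b → s ~ m → T m → ⊥
            b-and-branch sb sm Tm = exit-and-branch sb (inj₂ b∈) (~⇒≢ xb) sm Tm
              λ q un w⊑ vs (va , vb) → big-centre b∈ a∈ (λ eq → a≢b (≡-sym eq)) (λ eq → ~⇒≢ xb (≡-sym eq))
                (~⇒≢ ax) (sym xb) ax Dβ bβ q un w⊑ vs vb va sb

            tip-centre : ∀ {u p} → u ~ a × u ~ b → T u → u ≢ s → Leaf T u p → ¬ ¬ W G u
            tip-centre (ua , ub) Tu us lu =
              Swap.paired-leaf⇒⊥ (a ∷ []) (b ∷ []) e 3≤k (proj₁ Tu) ua ub (leaf-T⇒leaf Tu us lu)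

            two-T-neighbours : ∀ {m m′} → s ~ m → T m → s ~ m′ → T m′ → m ≢ m′ → ⊥
            two-T-neighbours sm Tm sm′ Tm′ mm = branch-and-branch sm Tm sm′ Tm′ mm
              λ q un w⊑ s∈ us vs uv lu lv u~ v~ →
                tip-centre u~ (w⊑ (walk-first q)) us lu λ Wu →
                tip-centre v~ (w⊑ (walk-last q)) vs lv λ Wv →
                max e (core-mono proj₁ (cycle⇒core q (sym (centres-adjacent Wu Wv uv)) un s∈
                  (λ eq → us (≡-sym eq)) (λ eq → vs (≡-sym eq)) w⊑))

            -- Now `s` plays the leaf, `x` is the vertex exchanged with it, and `t` is their common
            -- outer neighbour, so that `s` and `x` would be twins.
            both-exits : s ~ a → s ~ b → ⊥
            both-exits sa sb = Swap.WithLeaf.common-neighbour⇒⊥ (a ∷ []) (b ∷ []) e 3≤k ¬Rs sa sb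
              (¬Rt , ~⇒≢ ts) (sym ts) leaf-s (sym tx)
              where
              leaf-s : Leaf (λ v → ¬ R v) s t
              leaf-s {u} ¬Ru su with u ≟ t
              ... | yes eq = eq
              ... | no ut = ⊥-elim (a-and-branch sa su (¬Ru , ut))

            data Side (u : Fin n) : Set where
              is-a : u ≡ a → Side u
              is-b : u ≡ b → Side u
              in-T : T u → Side u

            side : ∀ {u} → s ~ u → u ≢ t → Side u
            side {u} su ut with classify u
            ... | inj₁ (inj₁ Du) = ⊥-elim (labelled-neighbours 3≤k ts ¬Dt (λ Ds → ¬Rs (inj₁ Ds)) Dd Du td su)
            ... | inj₁ (inj₂ (here eq)) = is-a eq
            ... | inj₁ (inj₂ (there (here refl))) = ⊥-elim (s≁x su)
            ... | inj₁ (inj₂ (there (there (here eq)))) = is-b eq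
            ... | inj₂ (inj₁ eq) = ⊥-elim (ut eq)
            ... | inj₂ (inj₂ Tu) = in-T Tu

            leaf⇒⊥ : ⊥
            leaf⇒⊥ = from (two-neighbours s t)
              where
              cases : ∀ {u u′} → s ~ u → s ~ u′ → u ≢ u′ → Side u → Side u′ → ⊥
              cases su su′ uu (is-a refl) (is-a refl) = uu refl
              cases su su′ uu (is-b refl) (is-b refl) = uu refl
              cases su su′ uu (is-a refl) (is-b refl) = both-exits su su′
              cases su su′ uu (is-b refl) (is-a refl) = both-exits su′ su
              cases su su′ uu (is-a refl) (in-T Tu′) = a-and-branch su su′ Tu′
              cases su su′ uu (is-b refl) (in-T Tu′) = b-and-branch su su′ Tu′
              cases su su′ uu (in-T Tu) (is-a refl) = a-and-branch su′ su Tu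
              cases su su′ uu (in-T Tu) (is-b refl) = b-and-branch su′ su Tu
              cases su su′ uu (in-T Tu) (in-T Tu′) = two-T-neighbours su Tu su′ Tu′ uu
              from : TwoNeighbours s t → ⊥
              from (u , u′ , su , ut , su′ , u′t , uu) = cases su su′ uu (side su ut) (side su′ u′t)

          leaf-centre : ∀ {α E β t p} → Ear D α E β → length E ≤ k → ¬ (D ⊕ E) t →
                        Leaf (λ v → ¬ (D ⊕ E) v) t p → ¬ ¬ W G t
          leaf-centre {α} {E} {β} {t} {p} e le ¬Rt leaf ¬Wt = locate (two-neighbours t p)
            where
            in-R : ∀ {u} → t ~ u → u ≢ p → (D ⊕ E) u
            in-R {u} tu up with ⊕-dec D? E u
            ... | yes r = r
            ... | no ¬r = ⊥-elim (up (leaf ¬r tu))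

            ¬Dt : ¬ D t
            ¬Dt Dt = ¬Rt (inj₁ Dt)

            last-neighbour : ∀ {x d} → t ~ x → D d → t ~ d → (∀ {v} → v ∈ E → v ≢ x → ¬ t ~ v) →
                             ¬ (D ⊕ E) p × t ~ p
            last-neighbour {x} {d} tx Dd td only = from (other-neighbour t x d)
              where
              from : (∃ λ s → t ~ s × s ≢ x × s ≢ d) → ¬ (D ⊕ E) p × t ~ p
              from (s , ts , sx , sd) with ⊕-dec D? E s
              ... | yes (inj₁ Ds) = ⊥-elim (sd (one-label ¬Dt Ds Dd ts td))
              ... | yes (inj₂ s∈) = ⊥-elim (only s∈ sx ts)
              ... | no ¬Rs with leaf ¬Rs ts
              ...   | refl = ¬Rs , ts

            two : ∀ {α β x₁ x₂ d} → Ear D α (x₁ ∷ x₂ ∷ []) β → (∀ {v} → v ∈ x₁ ∷ x₂ ∷ [] → v ∈ E) →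
                  (∀ {v} → v ∈ E → v ∈ x₁ ∷ x₂ ∷ []) → t ~ x₁ → D d → t ~ d → d ≢ α → d ≢ β → ⊥
            two {x₁ = x₁} {x₂} e′ to from tx Dd td dα dβ =
              finish (last-neighbour tx Dd td λ v∈ vx tv → only (from v∈) vx tv)
              where
              only : ∀ {v} → v ∈ x₁ ∷ x₂ ∷ [] → v ≢ x₁ → ¬ t ~ v
              only (here eq) vx tv = vx eq
              only (there (here refl)) vx tv = triangle-free tx tv (proj₁ (proj₂ (Ear.via e′)))
              finish : ¬ (D ⊕ E) p × t ~ p → ⊥
              finish (¬Rs , ts) = TwoEar.leaf⇒⊥ e′ (λ r → ¬Rt (map₂ to r)) (λ r → ¬Rs (map₂ to r)) ts
                (λ ¬r → leaf (λ r → ¬r (map₂ from r))) tx Dd td dα dβ ¬Wt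

            three : ∀ {a x b d} (e : Ear D α (a ∷ x ∷ b ∷ []) β) → length (a ∷ x ∷ b ∷ []) ≤ k →
              E ≡ a ∷ x ∷ b ∷ [] → t ~ x → D d → t ~ d → ⊥
            three e le refl tx Dd td = finish (last-neighbour tx Dd td λ
              { (here refl) vx tv → triangle-free tv tx (proj₁ (proj₂ (Ear.via e)))
              ; (there (here eq)) vx tv → vx eq
              ; (there (there (here refl))) vx tv → triangle-free tx tv (proj₁ (proj₂ (proj₂ (Ear.via e)))) })
              where
              finish : ¬ (D ⊕ E) p × t ~ p → ⊥
              finish (¬Rs , ts) = ThreeEar.leaf⇒⊥ le e ¬Rt ¬Rs ts leaf tx Dd td ¬Wt

            place : Position α E β t → ⊥
            place (paired as c bs refl ty tz) = Swap.paired-leaf⇒⊥ as bs e le ¬Rt ty tz leaf ¬Wt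
            place (third [] x [] refl _ _ tx Dd td dα dβ) = <⇒≱ 2≤k (short e)
            place (third [] x (b ∷ []) refl _ _ tx Dd td dα dβ) =
              two e (λ m → m) (λ m → m) tx Dd td dα dβ
            -- Reversal makes `x` the first vertex of the ear, as `TwoEar` expects.
            place (third (a ∷ []) x [] refl _ _ tx Dd td dα dβ) =
              two (ear-reverse e) swap swap tx Dd td dβ dα
              where
              swap : ∀ {u v w : Fin n} → u ∈ v ∷ w ∷ [] → u ∈ w ∷ v ∷ []
              swap (here eq) = there (here eq)
              swap (there (here eq)) = here eq
            place (third (a ∷ []) x (b ∷ []) refl _ _ tx Dd td dα dβ) = three e le refl tx Dd td
            place (third (_ ∷ _ ∷ _) _ _ _ (s≤s ()) _ _ _ _ _ _)
            place (third _ _ (_ ∷ _ ∷ _) _ _ (s≤s ()) _ _ _ _ _)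

            locate : TwoNeighbours t p → ⊥
            locate (g , h , tg , gp , th , hp , gh) = place (position e le ¬Rt (in-R tg gp) (in-R th hp) gh tg th)

          -- All outer vertices are centres, in particular `t` and `t₂`. A further neighbour `g` of
          -- `t` yields a third one: `g` itself if it is an outer vertex, and `x₂` if `g` lies in
          -- `D`, because then `t` can replace `x₂` on an ear ending at `g`.
          ear-of-length-two : ∀ {α x₁ x₂ β t t₂} → Ear D α (x₁ ∷ x₂ ∷ []) β → 2 ≤ k →
            x₁ ~ t → t ≢ α → t ≢ x₂ → x₂ ~ t₂ → t₂ ≢ x₁ → t₂ ≢ β → ⊥
          ear-of-length-two {α} {x₁} {x₂} {β} {t} {t₂} e le x₁t tα tx₂ x₂t₂ t₂x₁ t₂β =
            all-leaf-centres e (leaf-centre e le) ¬Rt λ leaf Wt →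
            all-leaf-centres e (leaf-centre e le) ¬Rt₂ λ _ Wt₂ → square Wt Wt₂ (other-neighbour t t₂ x₁)
            where
            E = x₁ ∷ x₂ ∷ []
            x₁x₂ = proj₁ (proj₂ (Ear.via e))
            ¬Rt : ¬ (D ⊕ E) t
            ¬Rt r = [ tα , tx₂ ] (ear-neighbours [] (x₂ ∷ []) e le r x₁t)
            ¬Rt₂ : ¬ (D ⊕ E) t₂
            ¬Rt₂ r = [ t₂x₁ , t₂β ] (ear-neighbours (x₁ ∷ []) [] e le r x₂t₂)
            t≢t₂ : t ≢ t₂
            t≢t₂ refl = triangle-free x₁x₂ x₁t x₂t₂
            square : W G t → W G t₂ → (∃ λ g → t ~ g × g ≢ t₂ × g ≢ x₁) → ⊥
            square Wt Wt₂ (g , tg , gt₂ , gx₁) with ⊕-dec D? E g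
            ... | no ¬Rg = all-leaf-centres e (leaf-centre e le) ¬Rg λ _ Wg →
                           no-three-centres Wt Wt₂ Wg t≢t₂ (~⇒≢ tg) (λ eq → gt₂ (≡-sym eq))
            ... | yes (inj₂ (here eq)) = gx₁ eq
            ... | yes (inj₂ (there (here refl))) = triangle-free x₁x₂ x₁t (sym tg)
            ... | yes (inj₁ Dg) with g ≟ α
            ...   | yes refl = triangle-free x₁t (sym (proj₁ (Ear.via e))) tg
            ...   | no gα = all-leaf-centres e₁ (leaf-centre e₁ le) ¬R₁x₂ λ _ Wx₂ →
                            no-three-centres Wt Wt₂ Wx₂ t≢t₂ tx₂ (λ eq → ~⇒≢ x₂t₂ (≡-sym eq))
              where
              e₁ : Ear D α (x₁ ∷ t ∷ []) g
              e₁ = walk⇒ear (x₁t ◅ stop) (cons-unique (λ { (here refl) → ~⇒≢ x₁t refl }) singleton-unique)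
                     (λ { (here refl) → Ear.outside e (here refl) ; (there (here refl)) → λ Dt → ¬Rt (inj₁ Dt) })
                     (proj₁ (Ear.via e)) tg (Ear.start∈ e) Dg (λ eq → gα (≡-sym eq))
              ¬R₁x₂ : ¬ (D ⊕ (x₁ ∷ t ∷ [])) x₂
              ¬R₁x₂ (inj₁ Dx) = Ear.outside e (there (here refl)) Dx
              ¬R₁x₂ (inj₂ (here eq)) = ~⇒≢ x₁x₂ (≡-sym eq)
              ¬R₁x₂ (inj₂ (there (here eq))) = tx₂ (≡-sym eq)

          -- The outer neighbours of three consecutive vertices are centres, and those of adjacent
          -- vertices differ, so `t` and `t₃` coincide. Then `t` is adjacent to both neighbours of
          -- `x₂` on the ear and, as a centre, to `t₂`: it would be a twin of `x₂`.
          longer-ear : ∀ {α x₁ x₂ x₃ E β t t₂ t₃} → Ear D α (x₁ ∷ x₂ ∷ x₃ ∷ E) β → length (x₁ ∷ x₂ ∷ x₃ ∷ E) ≤ k →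
            x₁ ~ t → t ≢ α → t ≢ x₂ → x₂ ~ t₂ → t₂ ≢ x₁ → t₂ ≢ x₃ → x₃ ~ t₃ → t₃ ≢ x₂ → t₃ ≢ hd E β → ⊥
          longer-ear {α} {x₁} {x₂} {x₃} {E} {β} {t} {t₂} {t₃} e le x₁t tα tx₂ x₂t₂ t₂x₁ t₂x₃ x₃t₃ t₃x₂ t₃z =
            all-leaf-centres e (leaf-centre e le) ¬Rt λ leaf Wt →
            all-leaf-centres e (leaf-centre e le) ¬Rt₂ λ _ Wt₂ →
            all-leaf-centres e (leaf-centre e le) ¬Rt₃ λ _ Wt₃ → same leaf Wt Wt₂ Wt₃
            where
            R = D ⊕ (x₁ ∷ x₂ ∷ x₃ ∷ E)
            x₁x₂ = proj₁ (proj₂ (Ear.via e))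
            x₂x₃ = proj₁ (proj₂ (proj₂ (Ear.via e)))
            ¬Rt : ¬ R t
            ¬Rt r = [ tα , tx₂ ] (ear-neighbours [] (x₂ ∷ x₃ ∷ E) e le r x₁t)
            ¬Rt₂ : ¬ R t₂
            ¬Rt₂ r = [ t₂x₁ , t₂x₃ ] (ear-neighbours (x₁ ∷ []) (x₃ ∷ E) e le r x₂t₂)
            ¬Rt₃ : ¬ R t₃
            ¬Rt₃ r = [ t₃x₂ , t₃z ] (ear-neighbours (x₁ ∷ x₂ ∷ []) E e le r x₃t₃)
            t≢t₂ : t ≢ t₂
            t≢t₂ refl = triangle-free x₁x₂ x₁t x₂t₂
            t₂≢t₃ : t₂ ≢ t₃
            t₂≢t₃ refl = triangle-free x₂x₃ x₂t₂ x₃t₃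
            same : ∀ {p} → Leaf (λ v → ¬ R v) t p → W G t → W G t₂ → W G t₃ → ⊥
            same leaf Wt Wt₂ Wt₃ with t ≟ t₃
            ... | no ne = no-three-centres Wt Wt₂ Wt₃ t≢t₂ ne t₂≢t₃
            ... | yes refl with centres-adjacent Wt Wt₂ t≢t₂
            ...   | tt₂ with leaf ¬Rt₂ tt₂
            ...     | refl = Swap.WithLeaf.common-neighbour⇒⊥ (x₁ ∷ []) (x₃ ∷ E) e le ¬Rt (sym x₁t) (sym x₃t₃)
                               (¬Rt₂ , λ eq → t≢t₂ (≡-sym eq)) tt₂ leaf x₂t₂

          no-ear : ∀ {α E β} → Ear D α E β → length E ≤ k → ⊥
          no-ear {E = []} e le = Ear.nonempty e refl
          no-ear {E = _ ∷ []} e le = <⇒≱ 2≤k (short e)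
          no-ear {α} {x₁ ∷ x₂ ∷ []} {β} e le = from (other-neighbour x₁ α x₂) (other-neighbour x₂ x₁ β)
            where
            from : (∃ λ t → x₁ ~ t × t ≢ α × t ≢ x₂) → (∃ λ t → x₂ ~ t × t ≢ x₁ × t ≢ β) → ⊥
            from (_ , x₁t , tα , tx₂) (_ , x₂t , tx₁ , tβ) = ear-of-length-two e le x₁t tα tx₂ x₂t tx₁ tβ
          no-ear {α} {x₁ ∷ x₂ ∷ x₃ ∷ E} {β} e le =
            from (other-neighbour x₁ α x₂) (other-neighbour x₂ x₁ x₃) (other-neighbour x₃ x₂ (hd E β))
            where
            from : (∃ λ t → x₁ ~ t × t ≢ α × t ≢ x₂) → (∃ λ t → x₂ ~ t × t ≢ x₁ × t ≢ x₃) →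
                   (∃ λ t → x₃ ~ t × t ≢ x₂ × t ≢ hd E β) → ⊥
            from (_ , x₁t , tα , tx₂) (_ , x₂t , tx₁ , tx₃) (_ , x₃t , t₃x₂ , t₃z) =
              longer-ear e le x₁t tα tx₂ x₂t tx₁ tx₃ x₃t t₃x₂ t₃z

        -- Ears with one vertex

        module _ (core : Core (λ v → ¬ D v)) where

          -- A vertex with at most one neighbour outside D lies in no core and has two neighbours in D,
          -- so it is an ear of D whose complement still has a core.
          two-outer-neighbours : ∀ {v p} → ¬ D v → ¬ Leaf (λ u → ¬ D u) v p
          two-outer-neighbours {v} {p} ¬Dv leaf = from (two-neighbours v p)
            where
            open Core core
            in-D : ∀ {u} → v ~ u → u ≢ p → D u
            in-D {u} vu up = decidable-stable (D? u) λ ¬Du → up (leaf ¬Du vu)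
            v∉ : v ∉ members
            v∉ m with two m
            ... | a , b , a∈ , b∈ , ab , va , vb = ab (trans (leaf (⊑S a∈) va) (≡-sym (leaf (⊑S b∈) vb)))
            from : TwoNeighbours v p → ⊥
            from (d , d′ , vd , dp , vd′ , d′p , dd′) = max
              (walk⇒ear stop singleton-unique (λ { (here refl) → ¬Dv }) (sym vd) vd′ (in-D vd dp) (in-D vd′ d′p) dd′)
              (mkCore members some∈ (λ m → [ ⊑S m , (λ { (here refl) → v∉ m }) ]) two)

          module OneEar {α x β} (e : Ear D α (x ∷ []) β) where

            R = D ⊕ (x ∷ [])

            outer : ∀ {u} → ¬ D u → u ≢ x → ¬ R u
            outer ¬Du ux (inj₁ Du) = ¬Du Du
            outer ¬Du ux (inj₂ (here eq)) = ux eq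

            ¬D-of : ∀ {u} → ¬ R u → ¬ D u
            ¬D-of ¬Ru Du = ¬Ru (inj₁ Du)

            -- Besides `p`, only `x` can be the second outer neighbour that `two-outer-neighbours`
            -- demands.
            leaf~x : ∀ {t p} → ¬ R t → Leaf (λ v → ¬ R v) t p → t ~ x
            leaf~x {t} {p} ¬Rt leaf with adj? t x
            ... | yes tx = tx
            ... | no t≁x = ⊥-elim (two-outer-neighbours {p = p} (¬D-of ¬Rt)
                    λ ¬Du tu → leaf (outer ¬Du λ { refl → t≁x tu }) tu)

            partner : ∀ {t p} → ¬ R t → Leaf (λ v → ¬ R v) t p → ¬ R p × t ~ p
            partner {t} {p} ¬Rt leaf with adj? t p | ⊕-dec D? (x ∷ []) p
            ... | yes tp | no ¬Rp = ¬Rp , tp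
            ... | no t≁p | _ = ⊥-elim (two-outer-neighbours {p = x} (¬D-of ¬Rt) only)
              where
              only : Leaf (λ u → ¬ D u) t x
              only {u} ¬Du tu with u ≟ x
              ... | yes eq = eq
              ... | no ux = ⊥-elim (t≁p (subst (t ~_) (leaf (outer ¬Du ux) tu) tu))
            ... | yes _ | yes Rp = ⊥-elim (two-outer-neighbours {p = x} (¬D-of ¬Rt) only)
              where
              only : Leaf (λ u → ¬ D u) t x
              only {u} ¬Du tu with u ≟ x
              ... | yes eq = eq
              ... | no ux = ⊥-elim (outer ¬Du ux (subst R (≡-sym (leaf (outer ¬Du ux) tu)) Rp))

            second : ∀ {s} t → ¬ R s → ¬ s ~ x → ∃ λ m → ¬ R m × s ~ m × m ≢ t
            second {s} t ¬Rs s≁x with any? (λ m → ¬? (⊕-dec D? (x ∷ []) m) ×-dec adj? s m ×-dec ¬? (m ≟ t))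
            ... | yes found = found
            ... | no none = ⊥-elim (two-outer-neighbours {p = t} (¬D-of ¬Rs) only)
              where
              only : Leaf (λ u → ¬ D u) s t
              only {u} ¬Du su with u ≟ t
              ... | yes eq = eq
              ... | no ut = ⊥-elim (none (u , outer ¬Du (λ { refl → s≁x su }) , su , ut))

            module LeafOf {t s d} (¬Rt : ¬ R t) (¬Rs : ¬ R s) (ts : t ~ s) (leaf : Leaf (λ v → ¬ R v) t s)
              (td : t ~ d) (d≢s : d ≢ s) (x≢d : x ≢ d) (¬Wt : ¬ W G t) where

              open AtLeaf e ¬Rt ¬Rs ts leaf hiding (R)

              tx : t ~ x
              tx = leaf~x ¬Rt leaf

              s≁x : ¬ s ~ x
              s≁x sx = triangle-free ts tx sx

              -- With a single vertex on the ear, every leaf is adjacent to it and no alternative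
              -- attachment remains.
              None : Pred (Fin n) 0ℓ
              None _ = ⊥

              tip : ∀ {v p} → T v → v ≢ s → Leaf T v p → v ~ x ⊎ None v
              tip Tv vs l = inj₁ (leaf~x (proj₁ Tv) (leaf-T⇒leaf Tv vs l))

              Rd : R d
              Rd = decidable-stable (⊕-dec D? (x ∷ []) d) λ ¬Rd → d≢s (leaf ¬Rd td)

              open Tips (inj₂ (here refl)) Rd tx td x≢d ¬Wt {None} tip

              cases : ∀ {m u} → s ~ m → T m → s ~ u → u ≢ t → m ≢ u → R u ⊎ u ≡ t ⊎ T u → ⊥
              cases sm Tm su ut mu (inj₁ (inj₁ Du)) =
                exit-and-branch su (inj₁ Du) (λ { refl → s≁x su }) sm Tm λ _ _ _ _ ()
              cases sm Tm su ut mu (inj₁ (inj₂ (here refl))) = s≁x su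
              cases sm Tm su ut mu (inj₂ (inj₁ eq)) = ut eq
              cases sm Tm su ut mu (inj₂ (inj₂ Tu)) = branch-and-branch sm Tm su Tu mu λ _ _ _ _ _ _ _ _ _ ()

              from-second : (∃ λ m → ¬ R m × s ~ m × m ≢ t) → ⊥
              from-second (m , ¬Rm , sm , mt) with other-neighbour s t m
              ... | u , su , ut , um = cases sm (¬Rm , mt) su ut (λ eq → um (≡-sym eq)) (classify u)

              leaf⇒⊥ : ⊥
              leaf⇒⊥ = from-second (second t ¬Rs s≁x)

            leaf-centre : ∀ {t p} → ¬ R t → Leaf (λ v → ¬ R v) t p → ¬ ¬ W G t
            leaf-centre {t} {s} ¬Rt leaf ¬Wt = from (partner ¬Rt leaf) (other-neighbour t s x)
              where
              from : ¬ R s × t ~ s → (∃ λ d → t ~ d × d ≢ s × d ≢ x) → ⊥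
              from (¬Rs , ts) (d , td , ds , dx) =
                LeafOf.leaf⇒⊥ ¬Rt ¬Rs ts leaf td ds (λ eq → dx (≡-sym eq)) ¬Wt

            -- Every outer vertex is a leaf and a centre, but a leaf `t`, its partner `s` and a
            -- second outer neighbour of `s` are three such vertices.
            absurd : ⊥
            absurd = with-vertex outer-vertex
              where
              open Core core
              outer-vertex : ∃ λ t → ¬ R t
              outer-vertex with some ≟ x
              ... | no ne = some , outer (⊑S some∈) ne
              ... | yes refl with two some∈
              ...   | a , b , a∈ , _ , _ , xa , _ = a , outer (⊑S a∈) (λ eq → ~⇒≢ xa (≡-sym eq))
              with-vertex : (∃ λ t → ¬ R t) → ⊥
              with-vertex (t , ¬Rt) = all-leaf-centres e leaf-centre ¬Rt λ leaf Wt →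
                three leaf Wt (partner ¬Rt leaf) (leaf~x ¬Rt leaf)
                where
                finish : ∀ {s} → W G t → t ~ s → ¬ R s → (∃ λ m → ¬ R m × s ~ m × m ≢ t) → ⊥
                finish Wt ts ¬Rs (m , ¬Rm , sm , mt) =
                  all-leaf-centres e leaf-centre ¬Rs λ _ Ws →
                  all-leaf-centres e leaf-centre ¬Rm λ _ Wm →
                  no-three-centres Wt Ws Wm (~⇒≢ ts) (λ eq → mt (≡-sym eq)) (~⇒≢ sm)
                three : ∀ {s} → Leaf (λ v → ¬ R v) t s → W G t → ¬ R s × t ~ s → t ~ x → ⊥
                three leaf Wt (¬Rs , ts) tx = finish Wt ts ¬Rs (second t ¬Rs (λ sx → triangle-free ts tx sx))

          module _ (no-twins : ∀ {a b} → ¬ D a → ¬ D b → ¬ Twins G a b) where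

            -- By induction on `k` no ear has fewer than `k` vertices, so that an ear within the
            -- bound is automatically a shortest one.
            no-ears : ∀ k {α E β} → Ear D α E β → length E ≤ k → ⊥
            no-ears zero {E = []} e le = Ear.nonempty e refl
            no-ears (suc k) {E = []} e le = Ear.nonempty e refl
            no-ears (suc zero) {E = x ∷ []} e le = OneEar.absurd e
            no-ears (suc zero) {E = _ ∷ _ ∷ _} e (s≤s ())
            no-ears (suc (suc k)) e le = LongEars.no-ear no-twins (s≤s (s≤s z≤n))
              (λ e′ → ≰⇒> λ le′ → no-ears (suc k) e′ le′) e le

      -- Growing the subgraph from an edge at the prescribed vertex

      module _ {r : Fin n} (no-twins : ∀ {a b} → a ≢ r → b ≢ r → ¬ Twins G a b) where

        -- F lists the complement of D; it shrinks each time an ear can be added to D.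
        no-core : ∀ m (F : List (Fin n)) → length F ≤ m → TwoConn (_∉ F) → r ∉ F →
                  ∀ {d d′} → d ∉ F → d′ ∉ F → d ≢ d′ → ¬ Core (λ v → ¬ v ∉ F)
        no-core m F le tc r∉ d∉ d′∉ dd core =
          stuck (ear-exists (λ v → ¬? (v ∈? F)) d∉ d′∉ dd (Core.⊑S core (Core.some∈ core)))
          where
          -- This supplies the maximality hypothesis `max`: an ear that leaves a core outside would
          -- make the larger subgraph a case of the induction hypothesis.
          shrink : ∀ m → length F ≤ m → ∀ {α E β} → Ear (_∉ F) α E β → ¬ Core (λ v → ¬ ((_∉ F) ⊕ E) v)
          shrink m le {E = []} e core′ = Ear.nonempty e refl
          shrink m le {α} {E₀@(x ∷ _)} e core′ = recurse m (<-≤-trans smaller le)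
            where
            F′ = filter (λ v → ¬? (v ∈? E₀)) F
            x∈F : x ∈ F
            x∈F = decidable-stable (x ∈? F) (Ear.outside e (here refl))
            smaller : length F′ < length F
            smaller = filter-notAll (λ v → ¬? (v ∈? E₀)) F (Any.map (λ { refl ¬x∈ → ¬x∈ (here refl) }) x∈F)
            enter : ∀ {v} → ((_∉ F) ⊕ E₀) v → v ∉ F′
            enter (inj₁ v∉) m∈ = v∉ (proj₁ (∈-filter⁻ (λ v → ¬? (v ∈? E₀)) m∈))
            enter (inj₂ v∈) m∈ = proj₂ (∈-filter⁻ (λ v → ¬? (v ∈? E₀)) {xs = F} m∈) v∈
            leave : ∀ {v} → v ∉ F′ → ((_∉ F) ⊕ E₀) v
            leave {v} v∉ with v ∈? E₀
            ... | yes v∈ = inj₂ v∈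
            ... | no v∉E = inj₁ λ v∈F → v∉ (∈-filter⁺ (λ v → ¬? (v ∈? E₀)) v∈F v∉E)
            recurse : ∀ m → length F′ < m → ⊥
            recurse (suc m) (s≤s le′) = no-core m F′ le′ (twoConn-mono enter leave (ear-twoConn tc e))
              (enter (inj₁ r∉)) (enter (inj₁ d∉)) (enter (inj₁ d′∉)) dd
              (core-mono (λ ¬R v∉ → ¬R (leave v∉)) core′)

          stuck : (∃ λ α → ∃ λ E → ∃ λ β → Ear (_∉ F) α E β) → ⊥
          stuck (α , E , β , e) = no-ears (λ v → ¬? (v ∈? F)) tc (shrink m le) core
            (λ ¬Da ¬Db → no-twins (λ { refl → ¬Da r∉ }) (λ { refl → ¬Db r∉ })) (length E) e ≤-refl

        module _ {s} (rs : r ~ s) {F : List (Fin n)} (enter : ∀ {v} → v ≡ r ⊎ v ≡ s → v ∉ F)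
          (leave : ∀ {v} → v ∉ F → v ≡ r ⊎ v ≡ s) where

          private
            edge-twoConn : TwoConn (_∉ F)
            edge-twoConn w {x} {y} x∉ y∉ xw yw with leave x∉ | leave y∉
            ... | inj₁ refl | inj₁ refl = path-refl (x∉ , xw)
            ... | inj₁ refl | inj₂ refl = path-edge (x∉ , xw) (y∉ , yw) rs
            ... | inj₂ refl | inj₁ refl = path-edge (x∉ , xw) (y∉ , yw) (sym rs)
            ... | inj₂ refl | inj₂ refl = path-refl (x∉ , xw)

            S : Pred (Fin n) 0ℓ
            S v = ¬ v ∉ F

            S? : Decidable S
            S? v = ¬? (¬? (v ∈? F))

            coreless : ¬ Core S
            coreless = no-core (length F) F ≤-refl edge-twoConn (enter (inj₁ refl))
                         (enter (inj₁ refl)) (enter (inj₂ refl)) (~⇒≢ rs)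

            -- Outside the edge there is no core, hence a leaf; its two neighbours besides `p` could
            -- only be `r` and `s`, and a triangle would arise.
            pendant⇒⊥ : ∀ {v p} → Leaf S v p → ⊥
            pendant⇒⊥ {v} {p} leaf = two (other-neighbour v p p)
              where
              end : ∀ {u} → v ~ u → u ≢ p → u ≡ r ⊎ u ≡ s
              end {u} vu up = leave (decidable-stable (¬? (u ∈? F)) λ Su → up (leaf Su vu))
              two : (∃ λ g → v ~ g × g ≢ p × g ≢ p) → ⊥
              two (g , vg , gp , _) with other-neighbour v p g
              ... | h , vh , hp , hg with end vg gp | end vh hp
              ...   | inj₁ refl | inj₁ refl = hg refl
              ...   | inj₂ refl | inj₂ refl = hg refl
              ...   | inj₁ refl | inj₂ refl = triangle-free rs (sym vg) (sym vh)
              ...   | inj₂ refl | inj₁ refl = triangle-free rs (sym vh) (sym vg)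

          all-but-edge⇒⊥ : ⊥
          all-but-edge⇒⊥ = from (fresh r s s)
            where
            S-fresh : ∀ {o} → o ∉ r ∷ s ∷ s ∷ [] → (o ∷ []) ⊑ S
            S-fresh o∉ (here refl) o∉F = [ (λ eq → o∉ (here eq)) , (λ eq → o∉ (there (here eq))) ] (leave o∉F)
            from-extension : ∀ {w y} → Extension S w y → ⊥
            from-extension ex = pendant⇒⊥ (Extension.leaf ex)
            from : (∃ λ o → o ∉ r ∷ s ∷ s ∷ []) → ⊥
            from (o , o∉) = from-extension (extend S? coreless (stop {o}) singleton-unique (S-fresh o∉))

        edge⇒⊥ : ∀ {s} → r ~ s → ⊥
        edge⇒⊥ {s} rs = all-but-edge⇒⊥ rs {filter outside? (allFin n)} enter leave
          where
          outside? : Decidable (_∉ r ∷ s ∷ [])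
          outside? v = ¬? (v ∈? r ∷ s ∷ [])
          enter : ∀ {v} → v ≡ r ⊎ v ≡ s → v ∉ filter outside? (allFin n)
          enter (inj₁ eq) m = proj₂ (∈-filter⁻ outside? {xs = allFin n} m) (here eq)
          enter (inj₂ eq) m = proj₂ (∈-filter⁻ outside? {xs = allFin n} m) (there (here eq))
          leave : ∀ {v} → v ∉ filter outside? (allFin n) → v ≡ r ⊎ v ≡ s
          leave {v} v∉ with v ∈? r ∷ s ∷ []
          ... | yes (here eq) = inj₁ eq
          ... | yes (there (here eq)) = inj₂ eq
          ... | no v∉pair = ⊥-elim (v∉ (∈-filter⁺ outside? (∈-allFin v) v∉pair))

        impossible : ⊥
        impossible = edge⇒⊥ (proj₁ (proj₂ (other-neighbour r r r)))

      -- Pairs of twins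

      twins? : ∀ a b → Dec (Twins G a b)
      twins? a b = ¬? (a ≟ b) ×-dec ¬? (adj? a b) ×-dec (degree G a ≟ⁿ 3) ×-dec (degree G b ≟ⁿ 3) ×-dec
                   ≡-dec _≟ᵇ_ (N G a) (N G b)

      twins-avoiding : ∀ r → ∃₂ λ a b → Twins G a b × a ≢ r × b ≢ r
      twins-avoiding r with any? (λ a → any? λ b → twins? a b ×-dec ¬? (a ≟ r) ×-dec ¬? (b ≟ r))
      ... | yes found = found
      ... | no none = ⊥-elim (impossible λ {a} {b} ar br tw → none (a , b , tw , ar , br))

      -- Three vertices with the same neighbourhood

      module Triplets {a b d} (tab : Twins G a b) (tbd : Twins G b d) (a≢d : a ≢ d) where

        a≢b : a ≢ b
        a≢b = proj₁ tab

        b≢d : b ≢ d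
        b≢d = proj₁ tbd

        Nab : N G a ≡ N G b
        Nab = proj₂ (proj₂ (proj₂ (proj₂ tab)))

        Nbd : N G b ≡ N G d
        Nbd = proj₂ (proj₂ (proj₂ (proj₂ tbd)))

        transfer : ∀ {v w u} → N G v ≡ N G w → v ~ u → w ~ u
        transfer {u = u} eq vu = ∈N⁻ (subst (u Sub.∈_) eq (∈N⁺ vu))

        a⇒b : ∀ {u} → a ~ u → b ~ u
        a⇒b = transfer Nab

        a⇒d : ∀ {u} → a ~ u → d ~ u
        a⇒d au = transfer Nbd (a⇒b au)

        D : Pred (Fin n) 0ℓ
        D v = v ∈ a ∷ b ∷ d ∷ [] ⊎ a ~ v

        D? : Decidable D
        D? v = (v ∈? a ∷ b ∷ d ∷ []) ⊎-dec adj? a v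

        -- All neighbours of `a`, `b` and `d` lie in `D`, so an edge leaving `D` starts at one of
        -- their common neighbours.
        end : ∀ {α x} → D α → ¬ D x → α ~ x → a ~ α
        end (inj₂ aα) ¬Dx αx = aα
        end (inj₁ (here refl)) ¬Dx αx = ⊥-elim (¬Dx (inj₂ αx))
        end (inj₁ (there (here refl))) ¬Dx αx = ⊥-elim (¬Dx (inj₂ (transfer (≡-sym Nab) αx)))
        end (inj₁ (there (there (here refl)))) ¬Dx αx =
          ⊥-elim (¬Dx (inj₂ (transfer (≡-sym (trans Nab Nbd)) αx)))

        -- The ear is closed through `β`, `u`, `γ`, `d`, `α`. This cycle avoids `v` and contains all
        -- three neighbours `α`, `β`, `γ` of `v`.
        around : ∀ {v u α β γ E} → v ∈ a ∷ b ∷ d ∷ [] → u ∈ a ∷ b ∷ d ∷ [] → v ≢ u → v ≢ d → u ≢ d →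
          (∀ {w} → a ~ w → v ~ w) → (∀ {w} → a ~ w → u ~ w) →
          Ear D α E β → a ~ α → a ~ β → a ~ γ → γ ≢ α → γ ≢ β → W G v
        around {E = []} _ _ _ _ _ _ _ e = ⊥-elim (Ear.nonempty e refl)
        around {v} {u} {α} {β} {γ} {E@(x ∷ _)} v∈ u∈ vu vd ud a⇒v a⇒u e aα aβ aγ γα γβ with via⇒walk (Ear.via e)
        ... | αx , y , p , yβ = wheel
          (walk-++ p yβ (sym (a⇒u aβ) ◅ a⇒u aγ ◅ sym (a⇒d aγ) ◅ a⇒d aα ◅ stop)) αx
          (++-unique (Ear.distinct e)
            (cons-unique (λ { (here eq) → ~⇒≢ (a⇒u aβ) (≡-sym eq) ; (there (here eq)) → γβ (≡-sym eq)
                            ; (there (there (here eq))) → ~⇒≢ (a⇒d aβ) (≡-sym eq)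
                            ; (there (there (there (here eq)))) → Ear.ends≢ e (≡-sym eq) })
              (cons-unique (λ { (here eq) → ~⇒≢ (a⇒u aγ) eq ; (there (here eq)) → ud eq
                              ; (there (there (here eq))) → ~⇒≢ (a⇒u aα) eq })
                (unique₃ (λ eq → ~⇒≢ (a⇒d aγ) (≡-sym eq)) γα (~⇒≢ (a⇒d aα)))))
            λ { m (here refl) → Ear.outside e m (inj₂ aβ) ; m (there (here refl)) → Ear.outside e m (inj₁ u∈)
              ; m (there (there (here refl))) → Ear.outside e m (inj₂ aγ)
              ; m (there (there (there (here refl)))) → Ear.outside e m (inj₁ (there (there (here refl))))
              ; m (there (there (there (there (here refl))))) → Ear.outside e m (inj₂ aα) })
          (λ m → [ (λ q → Ear.outside e q (inj₁ v∈))
                 , (λ { (here eq) → ~⇒≢ (a⇒v aβ) eq ; (there (here eq)) → vu eq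
                      ; (there (there (here eq))) → ~⇒≢ (a⇒v aγ) eq
                      ; (there (there (there (here eq)))) → vd eq
                      ; (there (there (there (there (here eq))))) → ~⇒≢ (a⇒v aα) eq }) ] (∈-++⁻ E m))
          (∈-++⁺ʳ E (there (there (there (there (here refl)))))) (∈-++⁺ʳ E (here refl))
          (∈-++⁺ʳ E (there (there (here refl)))) (a⇒v aα) (a⇒v aβ) (a⇒v aγ) (Ear.ends≢ e)
          (λ eq → γα (≡-sym eq)) (λ eq → γβ (≡-sym eq))

        -- The construction applies to `a` and to `b` alike, but these are not adjacent and so
        -- cannot both be centres.
        ear⇒⊥ : ∀ {α E β} → Ear D α E β → a ~ α → a ~ β → ∃ (λ γ → a ~ γ × γ ≢ α × γ ≢ β) → ⊥
        ear⇒⊥ e aα aβ (γ , aγ , γα , γβ) = proj₁ (proj₂ tab) (centres-adjacent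
          (around (here refl) (there (here refl)) a≢b a≢d b≢d (λ w → w) a⇒b e aα aβ aγ γα γβ)
          (around (there (here refl)) (here refl) (λ eq → a≢b (≡-sym eq)) b≢d a≢d a⇒b (λ w → w) e aα aβ aγ γα γβ)
          a≢b)

        ears⇒⊥ : (∃ λ α → ∃ λ E → ∃ λ β → Ear D α E β) → ⊥
        ears⇒⊥ (α , [] , β , e) = Ear.nonempty e refl
        ears⇒⊥ (α , E@(x ∷ _) , β , e) with via⇒walk (Ear.via e)
        ... | αx , y , p , yβ = ear⇒⊥ e (end (Ear.start∈ e) (Ear.outside e (here refl)) αx)
                (end (Ear.end∈ e) (Ear.outside e (walk-last p)) (sym yβ)) (other-neighbour a α β)

        everything : ∀ v → D v
        everything v = decidable-stable (D? v) λ ¬Dv →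
          ears⇒⊥ (ear-exists D? (inj₁ (here refl)) (inj₁ (there (here refl))) a≢b ¬Dv)

        -- By `everything` and triangle-freeness the graph is K₃,₃ with `a`, `b`, `d` as one side;
        -- `x` and `y` belong to the other.
        opposite : ∀ {x y} → a ~ x → a ~ y → x ≢ y → Twins G x y
        opposite ax ay xy = twins xy (triangle-free ax ay) a≢b a≢d b≢d (to ax) (to ay) (from ax) (from ay)
          where
          to : ∀ {x} → a ~ x → ∀ {v} → v ∈ a ∷ b ∷ d ∷ [] → x ~ v
          to ax (here refl) = sym ax
          to ax (there (here refl)) = sym (a⇒b ax)
          to ax (there (there (here refl))) = sym (a⇒d ax)
          from : ∀ {x} → a ~ x → ∀ {v} → x ~ v → v ∈ a ∷ b ∷ d ∷ []
          from ax {v} xv = [ (λ m → m) , (λ av → ⊥-elim (triangle-free ax av xv)) ]′ (everything v)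

      TwoDisjointPairs : Set
      TwoDisjointPairs = ∃₂ λ a b → ∃₂ λ c d → Twins G a b × Twins G c d × c ≢ a × d ≢ a × c ≢ b × d ≢ b

      disjoint : ∀ {a b c d} → Twins G a b → Twins G c d → c ≢ a → d ≢ a → c ≢ b → d ≢ b → TwoDisjointPairs
      disjoint p q ca da cb db = _ , _ , _ , _ , p , q , ca , da , cb , db

      triplet : ∀ {a b d} → Twins G a b → Twins G b d → a ≢ d → TwoDisjointPairs
      triplet {a} {b} {d} p q a≢d = from (other-neighbour a a a)
        where
        open Triplets p q a≢d
        from : (∃ λ x → a ~ x × x ≢ a × x ≢ a) → TwoDisjointPairs
        from (x , ax , _) with other-neighbour a x x
        ... | y , ay , yx , _ = disjoint p (opposite ax ay (λ eq → yx (≡-sym eq)))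
                (λ eq → ~⇒≢ ax (≡-sym eq)) (λ eq → ~⇒≢ ay (≡-sym eq))
                (λ eq → ~⇒≢ (a⇒b ax) (≡-sym eq)) (λ eq → ~⇒≢ (a⇒b ay) (≡-sym eq))

      twins-sym : ∀ {a b} → Twins G a b → Twins G b a
      twins-sym (ne , na , da , db , eq) = (λ e → ne (≡-sym e)) , (λ e → na (sym e)) , db , da , ≡-sym eq

      second-pair : ∀ {a b} → Twins G a b → (∃₂ λ c d → Twins G c d × c ≢ a × d ≢ a) → TwoDisjointPairs
      second-pair {a} {b} p (c , d , q , ca , da) with c ≟ b | d ≟ b
      ... | yes refl | _ = triplet p q (λ eq → da (≡-sym eq))
      ... | no _ | yes refl = triplet p (twins-sym q) (λ eq → ca (≡-sym eq))
      ... | no cb | no db = disjoint p q ca da cb db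

      two-disjoint-pairs : Fin n → TwoDisjointPairs
      two-disjoint-pairs r = from (twins-avoiding r)
        where
        from : (∃₂ λ a b → Twins G a b × a ≢ r × b ≢ r) → TwoDisjointPairs
        from (a , b , p , _) = second-pair p (twins-avoiding a)

open import Relation.Unary using (｛_｝; _∪_; _⊥_)

theorem6p6 : ∀ (n : ℕ) (G : Graph n) → AlmostWheelFree G → KConnected G 3 →
    ∃₂ λ a b → ∃₂ λ c d →
    Twins G a b × Twins G c d × (｛ a ｝ ∪ ｛ b ｝) ⊥ (｛ c ｝ ∪ ｛ d ｝)
theorem6p6 n G awf conn =
  -- Any vertex serves as the one avoided by the first pair; the bound `3 < n` inside `conn`
  -- provides vertex zero.
  from (two-disjoint-pairs G conn awf (fromℕ< {0} (≤-trans (s≤s z≤n) (proj₁ conn))))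
  where
  from : TwoDisjointPairs G conn awf → _
  from (a , b , c , d , p , q , ca , da , cb , db) = a , b , c , d , p , q ,
    λ { (inj₁ refl , inj₁ eq) → ca eq ; (inj₁ refl , inj₂ eq) → da eq
      ; (inj₂ refl , inj₁ eq) → cb eq ; (inj₂ refl , inj₂ eq) → db eq }
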